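{- Let $G$ be a 2-connected graph on $n$ vertices and let $C$ be a longest cycle in $G$, of length $c$, where $10\leq c\leq n-1$. If $e(G-V(C))+e(G-V(C),V(C))>(\lfloor c/2\rfloor-1)(n-c)$, then there exists a vertex $u$ that is isolated in $G-V(C)$ and has exactly $\lfloor c/2\rfloor$ neighbors on $C$.
   Context: Graphs are simple and finite. $G-V(C)$ is the graph obtained by deleting the vertices of $C$; $e(G-V(C),V(C))$ is the number of edges with one endpoint in $V(C)$ and the other outside $V(C)$. -}

module Defs where

open import Data.Nat using (ℕ; zero; suc; _+_; _≤_)
open import Data.Bool using (Bool; true; false; if_then_else_; _∧_; not)
open import Data.Fin using (Fin; toℕ; _≟_)
open import Data.List using (List; []; _∷_; allFin)
open import Data.Product using (_×_; Σ; ∃)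
open import Data.Sum using (_⊎_)
open import Relation.Binary.PropositionalEquality using (_≡_; _≢_)
open import Relation.Nullary using (does)
open import Function using (Injective)

record Graph (n : ℕ) : Set where
  field
    adj     : Fin n → Fin n → Bool
    adj-sym : ∀ x y → adj x y ≡ adj y x
    adj-irr : ∀ x → adj x x ≡ false
open Graph public

count : {A : Set} → (A → Bool) → List A → ℕ
count p [] = 0
count p (x ∷ xs) = if p x then suc (count p xs) else count p xs

countPairs : {A : Set} → (A → A → Bool) → List A → ℕ
countPairs p xs = go xs
  where
  go : _ → ℕ
  go [] = 0
  go (x ∷ ys) = count (p x) xs + go ys

data Walk {n : ℕ} (G : Graph n) (ok : Fin n → Set) : Fin n → Fin n → Set where
  nil  : ∀ {x} → ok x → Walk G ok x x
  cons : ∀ {x y z} → ok x → adj G x y ≡ true → Walk G ok y z → Walk G ok x z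

Connected : {n : ℕ} → Graph n → Set
Connected {n} G = ∀ (x y : Fin n) → Walk G (λ _ → ⊤') x y
  where
  open import Data.Unit using () renaming (⊤ to ⊤')

ConnectedMinus : {n : ℕ} → Graph n → Fin n → Set
ConnectedMinus {n} G v = ∀ (x y : Fin n) → x ≢ v → y ≢ v → Walk G (λ w → w ≢ v) x y

TwoConnected : {n : ℕ} → Graph n → Set
TwoConnected {n} G = (3 ≤ n) × Connected G × (∀ v → ConnectedMinus G v)

IsCycle : {n : ℕ} → Graph n → (c : ℕ) → (Fin c → Fin n) → Set
IsCycle G c f =
  (3 ≤ c) × Injective _≡_ _≡_ f ×
  (∀ i j → (suc (toℕ i) ≡ toℕ j ⊎ (suc (toℕ i) ≡ c × toℕ j ≡ 0)) →
     adj G (f i) (f j) ≡ true)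

IsLongestCycle : {n : ℕ} → Graph n → (c : ℕ) → (Fin c → Fin n) → Set
IsLongestCycle {n} G c f =
  IsCycle G c f × (∀ (c' : ℕ) (g : Fin c' → Fin n) → IsCycle G c' g → c' ≤ c)

onCycle : {n c : ℕ} → (Fin c → Fin n) → Fin n → Bool
onCycle {n} {c} f x = anyB (allFin c)
  where
  anyB : List (Fin c) → Bool
  anyB [] = false
  anyB (i ∷ is) = if does (f i ≟ x) then true else anyB is

-- e(G - V(C)): edges with both ends outside V(C), counted once (x < y)
eOutside : {n c : ℕ} → Graph n → (Fin c → Fin n) → ℕ
eOutside {n} G f =
  countPairs (λ x y → not (onCycle f x) ∧ not (onCycle f y) ∧ adj G x y
                      ∧ does (suc (toℕ x) Data.Nat.≤? toℕ y))
             (allFin n)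
  where import Data.Nat

eBetween : {n c : ℕ} → Graph n → (Fin c → Fin n) → ℕ
eBetween {n} G f =
  countPairs (λ x y → not (onCycle f x) ∧ onCycle f y ∧ adj G x y) (allFin n)

degOnCycle : {n c : ℕ} → Graph n → (Fin c → Fin n) → Fin n → ℕ
degOnCycle {n} G f u = count (λ y → onCycle f y ∧ adj G u y) (allFin n)

IsolatedOutside : {n c : ℕ} → Graph n → (Fin c → Fin n) → Fin n → Set
IsolatedOutside {n} G f u =
  onCycle f u ≡ false × (∀ w → onCycle f w ≡ false → adj G u w ≡ false)

-- Put k = ⌊c/2⌋ - 1 and suppose that no isolated vertex of G - V(C) has k + 1 neighbours on C. Then every vertex
-- outside C has at most k neighbours on C: for a non-isolated one, 2-connectedness gives a path through at least two
-- outside vertices back to C, and the gaps it forces between the attachments leave no room for k + 1 of them.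
--
-- Under this assumption e(H) + e(H, C) ≤ k|H| for every set H of vertices outside C, by induction on |H|: it suffices
-- to find a nonempty S ⊆ H with deg_H(s) + deg_{H∖S}(s) + 2 deg_C(s) ≤ 2k for all s ∈ S. If some v ∈ H has
-- deg_H(v) + deg_C(v) ≤ k, take S = {v}. Otherwise take a longest path P = x ⋯ y in H and let S be the set of ends
-- obtained from x by Pósa rotations with y fixed, where P is chosen such that y has a neighbour on C if possible and
-- such that deg_H(x) is then maximal. So deg_H(s) ≤ deg_H(x) ≤ |S|, and if all neighbours of S in H lie in a set
-- R ⊇ S of vertices, the sum of the first two degrees is at most |R|.
--
-- Comparing the attachments of s and y on C shows that deg_C(s) ≤ 1, or deg_C(s) ≤ 2 and |P| ≤ k. If |P| ≤ k, let R
-- be the vertex set of P. Otherwise let R consist of the first 2k - 2 vertices of P: a neighbour further away would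
-- close a cycle outside C with more than 2k - 2 vertices, and two disjoint paths from that cycle to C would produce
-- a cycle longer than C.
module Submission where

open import Defs
open import Data.Nat
open import Data.Nat.Properties
open import Data.Nat.DivMod
  using (_/_; _%_; _mod_; m≡m%n+[m/n]*n; [m+kn]%n≡m%n; [m+n]%n≡m%n; m%n<n; m<n⇒m%n≡m; n%n≡0)
open import Data.Nat.Induction using (<-wellFounded)
open import Data.Nat.Tactic.RingSolver using (solve-∀)
import Data.Nat.ListAction
open import Data.Bool using (Bool; true; false; if_then_else_; _∧_; _∨_; not)
import Data.Bool.Properties as Bool
open import Data.Fin using (Fin; toℕ)
import Data.Fin as Fin
import Data.Fin.Properties as Fin
open import Data.List
  using (List; []; _∷_; _++_; [_]; map; length; lookup; filter; reverse; take; tabulate; allFin)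
open import Data.List.Properties
open import Data.List.Membership.Propositional using (_∈_; _∉_)
open import Data.List.Membership.Propositional.Properties
import Data.List.Membership.DecPropositional
open import Data.List.Relation.Unary.Any using (here; there)
import Data.List.Relation.Unary.Any.Properties as Any
open import Data.List.Relation.Unary.All as All using (All; []; _∷_)
open import Data.List.Relation.Unary.AllPairs using ([]; _∷_)
open import Data.List.Relation.Unary.Unique.Propositional using (Unique)
import Data.List.Relation.Unary.Unique.Propositional.Properties as Unique
open import Data.List.Relation.Binary.Permutation.Propositional
  using (_↭_; ↭-refl; ↭-sym; ↭⇒↭ₛ; module PermutationReasoning)
open import Data.List.Relation.Binary.Permutation.Propositional.Properties
  using (↭-reverse; ↭-length; ++⁺; ++⁺ʳ; shifts; ∈-resp-↭)
import Data.List.Relation.Binary.Permutation.Setoid.Properties as Permutation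
open import Data.Product using (∃; ∃₂; _×_; _,_; proj₁; proj₂)
open import Data.Sum using (_⊎_; inj₁; inj₂)
open import Data.Empty using (⊥; ⊥-elim)
open import Function using (_∘_; Injective)
open import Induction.WellFounded using (Acc; acc)
open import Relation.Nullary
open import Relation.Nullary.Decidable using (decidable-stable; dec-true; dec-false)
open import Relation.Binary.Definitions using (tri<; tri≈; tri>)
open import Relation.Binary.PropositionalEquality hiding ([_])
open import Algebra.Properties.Semiring.Sum +-*-semiring
  using (sum; ∑-distrib-+; ∑-comm; *-distribˡ-sum; sum-cong-≗)

-- Counting

length-⊆ : {A : Set} {xs ys : List A} → Unique xs → (∀ {x} → x ∈ xs → x ∈ ys) → length xs ≤ length ys
length-⊆ [] _ = z≤n
length-⊆ {xs = x ∷ xs} (x∉ ∷ u) sub with ∈-∃++ (sub (here refl))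
... | as , bs , refl = begin
    suc (length xs)          ≤⟨ s≤s (length-⊆ u sub′) ⟩
    suc (length (as ++ bs))  ≡⟨ cong suc (length-++ as) ⟩
    suc (length as + length bs) ≡⟨ +-suc (length as) (length bs) ⟨
    length as + suc (length bs) ≡⟨ length-++ as ⟨
    length (as ++ x ∷ bs)    ∎
  where
  open ≤-Reasoning
  sub′ : ∀ {z} → z ∈ xs → z ∈ as ++ bs
  sub′ z∈ with ∈-++⁻ as (sub (there z∈))
  ... | inj₁ p = ∈-++⁺ˡ p
  ... | inj₂ (here refl) = ⊥-elim (All.lookup x∉ z∈ refl)
  ... | inj₂ (there p) = ∈-++⁺ʳ as p

true? : {A : Set} (p : A → Bool) (x : A) → Dec (p x ≡ true)
true? p x = p x Bool.≟ true

count-filter : {A : Set} (p : A → Bool) (xs : List A) → count p xs ≡ length (filter (true? p) xs)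
count-filter p [] = refl
count-filter p (x ∷ xs) with p x
... | true = cong suc (count-filter p xs)
... | false = count-filter p xs

# : ∀ {n} → (Fin n → Bool) → ℕ
# {n} p = count p (allFin n)

#≤length : ∀ {n} {p : Fin n → Bool} {l} → (∀ i → p i ≡ true → i ∈ l) → # p ≤ length l
#≤length {n} {p} h rewrite count-filter p (allFin n) =
  length-⊆ (Unique.filter⁺ (true? p) (Unique.allFin⁺ n)) (λ i∈ → h _ (proj₂ (∈-filter⁻ (true? p) {xs = allFin n} i∈)))

length≤# : ∀ {n} {p : Fin n → Bool} {l} → Unique l → (∀ {i} → i ∈ l → p i ≡ true) → length l ≤ # p
length≤# {n} {p} u h rewrite count-filter p (allFin n) =
  length-⊆ u (λ i∈ → ∈-filter⁺ (true? p) (∈-allFin _) (h i∈))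

count-mono : {A : Set} {p q : A → Bool} → (∀ i → p i ≡ true → q i ≡ true) → ∀ xs → count p xs ≤ count q xs
count-mono h [] = z≤n
count-mono {p = p} {q} h (x ∷ xs) with p x in ep | q x in eq
... | false | false = count-mono h xs
... | false | true = m≤n⇒m≤1+n (count-mono h xs)
... | true | true = s≤s (count-mono h xs)
... | true | false with () ← trans (sym (h x ep)) eq

count-cong : {A : Set} {p q : A → Bool} → (∀ i → p i ≡ q i) → ∀ xs → count p xs ≡ count q xs
count-cong h [] = refl
count-cong h (x ∷ xs) rewrite h x | count-cong h xs = refl

count-not : {A : Set} (p : A → Bool) (xs : List A) → count p xs + count (not ∘ p) xs ≡ length xs
count-not p [] = refl
count-not p (x ∷ xs) with p x
... | true = cong suc (count-not p xs)
... | false = trans (+-suc _ _) (cong suc (count-not p xs))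

𝟙 : Bool → ℕ
𝟙 true = 1
𝟙 false = 0

count-tabulate : ∀ {A : Set} {n} (p : A → Bool) (f : Fin n → A) → count p (tabulate f) ≡ sum (λ i → 𝟙 (p (f i)))
count-tabulate {n = zero} p f = refl
count-tabulate {n = suc n} p f with p (f Fin.zero)
... | true = cong suc (count-tabulate p (f ∘ Fin.suc))
... | false = count-tabulate p (f ∘ Fin.suc)

#-sum : ∀ {n} (p : Fin n → Bool) → # p ≡ sum (λ i → 𝟙 (p i))
#-sum p = count-tabulate p (λ i → i)

sum-mono : ∀ {n} {f g : Fin n → ℕ} → (∀ i → f i ≤ g i) → sum f ≤ sum g
sum-mono {zero} h = z≤n
sum-mono {suc n} h = +-mono-≤ (h Fin.zero) (sum-mono (λ i → h (Fin.suc i)))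

#-pos : ∀ {n} {p : Fin n → Bool} → 1 ≤ # p → ∃ λ i → p i ≡ true
#-pos {n} {p} h with filter (true? p) (allFin n) in eq | count-filter p (allFin n)
... | [] | e with () ← subst (1 ≤_) e h
... | i ∷ l | e = i , proj₂ (∈-filter⁻ (true? p) {xs = allFin n} (subst (i ∈_) (sym eq) (here refl)))

∧-trueˡ : ∀ {a b} → a ∧ b ≡ true → a ≡ true
∧-trueˡ {true} _ = refl

∧-trueʳ : ∀ {a b} → a ∧ b ≡ true → b ≡ true
∧-trueʳ {true} e = e

-- The loops inside countPairs and onCycle are local to Defs and have no name here: the with-abstractions
-- generalise their list argument, so that unification can solve the underscores by them.
countPairs-go : {A : Set} (p : A → A → Bool) (zs ys : List A) →
  _ ≡ Data.Nat.ListAction.sum (map (λ x → count (p x) zs) ys)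
countPairs-map : {A : Set} (p : A → A → Bool) (xs : List A) →
  countPairs p xs ≡ Data.Nat.ListAction.sum (map (λ x → count (p x) xs) xs)
countPairs-map p [] = refl
countPairs-map {A} p (x ∷ xs) with x ∷ xs in eq
... | zs = cong ((if p x x then suc (count (p x) xs) else count (p x) xs) +_)
             (trans (countPairs-go p zs xs)
                    (cong (λ ws → Data.Nat.ListAction.sum (map (λ y → count (p y) ws) xs)) (sym eq)))
countPairs-go p zs [] = refl
countPairs-go p zs (y ∷ ys) = cong (count (p y) zs +_) (countPairs-go p zs ys)

sum-map-tabulate : ∀ {A : Set} {n} (g : A → ℕ) (f : Fin n → A) →
  Data.Nat.ListAction.sum (map g (tabulate f)) ≡ sum (g ∘ f)
sum-map-tabulate {n = zero} g f = refl
sum-map-tabulate {n = suc n} g f = cong (g (f Fin.zero) +_) (sum-map-tabulate g (f ∘ Fin.suc))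

countPairs-sum : ∀ {n} (p : Fin n → Fin n → Bool) → countPairs p (allFin n) ≡ sum (λ x → # (p x))
countPairs-sum {n} p = trans (countPairs-map p (allFin n)) (sum-map-tabulate (λ x → # (p x)) (λ i → i))
onCycle⁺ : ∀ {n c} (f : Fin c → Fin n) {x} i → f i ≡ x → onCycle f x ≡ true
onCycle⁺-go : ∀ {n c} (f : Fin c → Fin n) x i (is : List (Fin c)) → f i ≡ x → i ∈ is → _ ≡ true
onCycle⁺ {n} {c} f {x} i e with allFin c | ∈-allFin i
... | is | p = onCycle⁺-go f x i is e p
onCycle⁺-go f x i (j ∷ is) e p with f j Fin.≟ x
... | yes _ = refl
onCycle⁺-go f x i (j ∷ is) e (here refl) | no q with () ← q e
onCycle⁺-go f x i (j ∷ is) e (there p) | no q = onCycle⁺-go f x i is e p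

onCycle⁻ : ∀ {n c} (f : Fin c → Fin n) x → onCycle f x ≡ true → ∃ λ i → f i ≡ x
onCycle⁻-go : ∀ {n c} (f : Fin c → Fin n) x (is : List (Fin c)) → _ ≡ true → ∃ λ i → f i ≡ x
onCycle⁻ {n} {c} f x e with allFin c
... | is = onCycle⁻-go f x is e
onCycle⁻-go f x (j ∷ is) e with f j Fin.≟ x
... | yes p = j , p
... | no _ = onCycle⁻-go f x is e

-- Injectivity of `C` lets vertices on the cycle be counted by their positions.
#-onCycle : ∀ {n c} (C : Fin c → Fin n) → Injective _≡_ _≡_ C → (q : Fin n → Bool) →
  # (λ y → onCycle C y ∧ q y) ≡ # (q ∘ C)
#-onCycle {n} {c} C inj q = ≤-antisym
  (subst (# (λ y → onCycle C y ∧ q y) ≤_) len (#≤length onto))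
  (subst (_≤ # (λ y → onCycle C y ∧ q y)) len (length≤# (Unique.map⁺ inj (Unique.filter⁺ (true? (q ∘ C))
      (Unique.allFin⁺ c))) into))
  where
  l : List (Fin n)
  l = map C (filter (true? (q ∘ C)) (allFin c))
  len : length l ≡ # (q ∘ C)
  len = trans (length-map C (filter (true? (q ∘ C)) (allFin c))) (sym (count-filter (q ∘ C) (allFin c)))
  onto : ∀ y → onCycle C y ∧ q y ≡ true → y ∈ l
  onto y e with onCycle⁻ C y (∧-trueˡ e)
  ... | i , refl = ∈-map⁺ C (∈-filter⁺ (true? (q ∘ C)) (∈-allFin i) (∧-trueʳ {onCycle C y} e))
  into : ∀ {y} → y ∈ l → onCycle C y ∧ q y ≡ true
  into y∈ with ∈-map⁻ C y∈
  ... | i , i∈ , refl rewrite onCycle⁺ C i refl = proj₂ (∈-filter⁻ (true? (q ∘ C)) {xs = allFin c} i∈)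

-- A form of linear arithmetic for the ring solver: both sides of a known inequality are displayed
-- as the wanted sides plus a common summand `r`.
≤-by-cancel : ∀ {a b} x y r → a ≤ b → a ≡ x + r → b ≡ y + r → x ≤ y
≤-by-cancel x y r h ea eb = +-cancelʳ-≤ r x y (subst₂ _≤_ ea eb h)

∨-true : ∀ {a b} → a ∨ b ≡ true → a ≡ true ⊎ b ≡ true
∨-true {true} _ = inj₁ refl
∨-true {false} e = inj₂ e

∨-trueˡ : ∀ {a b} → a ≡ true → a ∨ b ≡ true
∨-trueˡ refl = refl

∨-trueʳ : ∀ {a b} → b ≡ true → a ∨ b ≡ true
∨-trueʳ {true} _ = refl
∨-trueʳ {false} e = e

-- Counting along the cycle

cnt : (ℕ → Bool) → ℕ → ℕ → ℕ
cnt M a zero = 0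
cnt M a (suc L) = 𝟙 (M a) + cnt M (suc a) L

cnt-+ : ∀ M a L₁ L₂ → cnt M a (L₁ + L₂) ≡ cnt M a L₁ + cnt M (a + L₁) L₂
cnt-+ M a zero L₂ = cong (λ b → cnt M b L₂) (sym (+-identityʳ a))
cnt-+ M a (suc L₁) L₂ = begin
  𝟙 (M a) + cnt M (suc a) (L₁ + L₂)                           ≡⟨ cong (𝟙 (M a) +_) (cnt-+ M (suc a) L₁ L₂) ⟩
  𝟙 (M a) + (cnt M (suc a) L₁ + cnt M (suc a + L₁) L₂)        ≡⟨ +-assoc (𝟙 (M a)) _ _ ⟨
  𝟙 (M a) + cnt M (suc a) L₁ + cnt M (suc (a + L₁)) L₂
      ≡⟨ cong (λ b → 𝟙 (M a) + cnt M (suc a) L₁ + cnt M b L₂) (+-suc a L₁) ⟨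
  𝟙 (M a) + cnt M (suc a) L₁ + cnt M (a + suc L₁) L₂          ∎
  where open ≡-Reasoning

Periodic : ℕ → (ℕ → Bool) → Set
Periodic c M = ∀ i → M (i + c) ≡ M i

-- Moving the window by one position loses `M a` and gains `M (a + c)`, which agree by periodicity.
cnt-shift : ∀ {c M} → Periodic c M → ∀ a → cnt M a c ≡ cnt M 0 c
cnt-shift per zero = refl
cnt-shift {c} {M} per (suc a) = trans (+-cancelˡ-≡ (𝟙 (M a)) _ _ (begin
    cnt M a (1 + c)                     ≡⟨ cong (cnt M a) (+-comm 1 c) ⟩
    cnt M a (c + 1)                     ≡⟨ cnt-+ M a c 1 ⟩
    cnt M a c + (𝟙 (M (a + c)) + 0)     ≡⟨ cong (cnt M a c +_) (trans (+-identityʳ _) (cong 𝟙 (per a))) ⟩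
    cnt M a c + 𝟙 (M a)                 ≡⟨ +-comm (cnt M a c) _ ⟩
    𝟙 (M a) + cnt M a c                 ∎)) (cnt-shift per a)
  where open ≡-Reasoning

cnt-mono : ∀ {X M : ℕ → Bool} → (∀ i → X i ≡ true → M i ≡ true) → ∀ a L → cnt X a L ≤ cnt M a L
cnt-mono h a zero = z≤n
cnt-mono {X} {M} h a (suc L) with X a in eX | M a in eM
... | true | true = s≤s (cnt-mono h (suc a) L)
... | true | false with () ← trans (sym (h a eX)) eM
cnt-mono h a (suc L) | false | true = m≤n⇒m≤1+n (cnt-mono h (suc a) L)
cnt-mono h a (suc L) | false | false = cnt-mono h (suc a) L

-- If `X` missed the first position, the remaining ones could not make up for it. The first position
-- suffices because the window of a periodic set may start anywhere.
cnt-head : ∀ {X M : ℕ → Bool} → (∀ i → X i ≡ true → M i ≡ true) → ∀ a L → 1 ≤ L →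
  cnt X a L ≡ cnt M a L → M a ≡ true → X a ≡ true
cnt-head {X} {M} h a (suc L) _ e Ma with X a
... | true = refl
... | false rewrite Ma = ⊥-elim (1+n≰n (subst (_≤ cnt M (suc a) L) e (cnt-mono h (suc a) L)))

cnt-zero : ∀ {M : ℕ → Bool} a L → (∀ t → t < L → M (a + t) ≡ false) → cnt M a L ≡ 0
cnt-zero a zero h = refl
cnt-zero {M} a (suc L) h rewrite trans (cong M (sym (+-identityʳ a))) (h 0 z<s) =
  cnt-zero {M} (suc a) L (λ t t< → trans (cong M (sym (+-suc a t))) (h (suc t) (s<s t<)))

-- Positions are unrolled to ℕ, so that a gap condition also covers pairs of positions around the origin.
Gap : ℕ → (ℕ → Bool) → (ℕ → Bool) → Set
Gap g X Y = ∀ {i j} → i < j → X i ≡ true → Y j ≡ true → i + g ≤ j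

-- Each counted position leaves a debt of `g` free positions, and `e` is the part of it still unpaid
-- at `a`. Since a member follows the window, the last debt is paid inside it.
gap-count-arc : ∀ {g M} → Gap (suc g) M M → ∀ L a e → (∀ t → t < e → M (a + t) ≡ false) →
  M (a + L) ≡ true → e + suc g * cnt M a L ≤ L
gap-count-arc {g} gap zero a zero free end = ≤-reflexive (*-zeroʳ (suc g))
gap-count-arc gap zero a (suc e) free end with () ← trans (sym end) (free 0 z<s)
gap-count-arc {g} {M} gap (suc L) a (suc e) free end
  with M a | trans (cong M (sym (+-identityʳ a))) (free 0 z<s)
... | false | refl = s≤s (gap-count-arc gap L (suc a) e
  (λ t t< → trans (cong M (sym (+-suc a t))) (free (suc t) (s<s t<))) (trans (cong M (sym (+-suc a L))) end))
gap-count-arc {g} {M} gap (suc L) a zero free end with M a in eq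
... | false = m≤n⇒m≤1+n (gap-count-arc gap L (suc a) zero (λ _ ()) (trans (cong M (sym (+-suc a L))) end))
... | true = ≤-trans (≤-reflexive (*-suc (suc g) (cnt M (suc a) L)))
  (s≤s (gap-count-arc gap L (suc a) g free′ (trans (cong M (sym (+-suc a L))) end)))
  where
  free′ : ∀ t → t < g → M (suc a + t) ≡ false
  free′ t t< with M (suc a + t) in e
  ... | false = refl
  ... | true = ⊥-elim (<⇒≱ t< (s≤s⁻¹ (+-cancelˡ-≤ a _ _ (subst (a + suc g ≤_) (sym (+-suc a t)) (gap (s≤s
      (m≤m+n a t)) eq e)))))

-- A full turn that starts at a member is also followed by one, namely the same position one turn
-- later.
gap-count : ∀ {c g M} → Periodic c M → Gap (suc g) M M → ∀ i → M i ≡ true → suc g * cnt M 0 c ≤ c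
gap-count {c} {g} {M} per gap i Mi = subst (λ x → suc g * x ≤ c) (cnt-shift per i)
  (gap-count-arc gap c i zero (λ _ ()) (trans (per i) Mi))

2-gap-count : ∀ {c M} → Periodic c M → Gap 2 M M → 2 * cnt M 0 c ≤ c
2-gap-count {c} {M} per gap with anyUpTo? (λ i → M i Bool.≟ true) c
... | yes (i , _ , Mi) = gap-count per gap i Mi
... | no none rewrite cnt-zero {M} 0 c (λ t t< → Bool.¬-not (λ e → none (t , t< , e))) = z≤n

𝟙≤1 : ∀ b → 𝟙 b ≤ 1
𝟙≤1 true = ≤-refl
𝟙≤1 false = z≤n

-- δ is the distance from the last position of X, which is paid back when a position of Y is reached.
arc-count : ∀ {X Y p} → Gap 2 (λ i → X i ∨ Y i) (λ i → X i ∨ Y i) → Gap (suc p) X Y →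
  ∀ L a δ → X a ≡ true → Y (a + suc δ + L) ≡ true →
  suc p + 2 * cnt (λ i → X i ∨ Y i) (a + suc δ) L ≤ L + suc δ
arc-count {X} {Y} {p} gap gapXY zero a δ Xa Yend = begin
  suc p + 0   ≡⟨ +-identityʳ _ ⟩
  suc p       ≤⟨ +-cancelˡ-≤ a _ _ (gapXY (m<m+n a z<s) Xa (trans (cong Y (sym (+-identityʳ _))) Yend)) ⟩
  suc δ       ∎
  where open ≤-Reasoning
arc-count {X} {Y} {p} gap gapXY (suc L) a δ Xa Yend with true? Y (a + suc δ) | true? X (a + suc δ)
-- The wide gap ends here and pays `suc p`; from now on gaps of 2 suffice.
... | yes eY | _ = begin
  suc p + 2 * cnt M b (suc L)  ≤⟨ +-mono-≤ (+-cancelˡ-≤ a _ _ (gapXY (m<m+n a z<s) Xa eY))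
                                   (gap-count-arc gap (suc L) b zero (λ _ ()) (∨-trueʳ Yend)) ⟩
  suc δ + suc L                ≡⟨ +-comm (suc δ) _ ⟩
  suc L + suc δ                ∎
  where
  open ≤-Reasoning
  M : ℕ → Bool
  M i = X i ∨ Y i
  b = a + suc δ
-- The distance `suc δ` from the previous position of `X` is at least 2, which pays for counting
-- this one; the measurement restarts here.
... | no nY | yes eX = begin
  suc p + 2 * (𝟙 (M b) + cnt M (suc b) L)
      ≤⟨ +-monoʳ-≤ (suc p) (*-monoʳ-≤ 2 (+-monoˡ-≤ (cnt M (suc b) L) (𝟙≤1 (M b)))) ⟩
  suc p + 2 * suc (cnt M (suc b) L)         ≡⟨ rearrange (suc p) _ ⟩
  suc p + 2 * cnt M (suc b) L + 2           ≡⟨ cong (λ z → suc p + 2 * cnt M z L + 2) (+-comm 1 b) ⟩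
  suc p + 2 * cnt M (b + 1) L + 2
      ≤⟨ +-mono-≤ (arc-count gap gapXY L b 0 eX (subst (λ z → Y z ≡ true) (shift b L) Yend))
                                                        (+-cancelˡ-≤ a _ _ (gap (m<m+n a z<s) (∨-trueˡ Xa)
                                                            (∨-trueˡ eX))) ⟩
  L + 1 + suc δ                             ≡⟨ cong (_+ suc δ) (+-comm L 1) ⟩
  suc L + suc δ                             ∎
  where
  open ≤-Reasoning
  M : ℕ → Bool
  M i = X i ∨ Y i
  b = a + suc δ
  rearrange : ∀ q x → q + 2 * suc x ≡ q + 2 * x + 2
  rearrange = solve-∀
  shift : ∀ x y → x + suc y ≡ x + 1 + y
  shift = solve-∀
... | no nY | no nX = begin
  suc p + 2 * (𝟙 (M b) + cnt M (suc b) L)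
      ≡⟨ cong (λ z → suc p + 2 * (𝟙 z + cnt M (suc b) L)) (cong₂ _∨_ (Bool.¬-not nX) (Bool.¬-not nY)) ⟩
  suc p + 2 * cnt M (suc b) L                ≡⟨ cong (λ z → suc p + 2 * cnt M z L) (sym (+-suc a (suc δ))) ⟩
  suc p + 2 * cnt M (a + suc (suc δ)) L
      ≤⟨ arc-count gap gapXY L a (suc δ) Xa (subst (λ z → Y z ≡ true) (shift a δ L) Yend) ⟩
  L + suc (suc δ)                            ≡⟨ +-suc L (suc δ) ⟩
  suc L + suc δ                              ∎
  where
  open ≤-Reasoning
  M : ℕ → Bool
  M i = X i ∨ Y i
  b = a + suc δ
  shift : ∀ x y z → x + suc y + suc z ≡ x + suc (suc y) + z
  shift = solve-∀

-- The m marked positions cut the cycle into m gaps. The arc from `i` to `j` and the arc from `j` to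
-- `i + c` each contain a gap of length at least p + 1 where the type changes, and the other m - 2
-- gaps have length at least 2.
two-type-count : ∀ {c X Y p} → Periodic c X → Periodic c Y →
  Gap 2 (λ i → X i ∨ Y i) (λ i → X i ∨ Y i) → Gap (suc p) X Y → Gap (suc p) Y X →
  ∀ {i j} → i < j → j < i + c → X i ≡ true → Y j ≡ true →
  (2 * p + 2 * cnt (λ t → X t ∨ Y t) 0 c ≤ c + 2) × (2 ≤ cnt (λ t → X t ∨ Y t) 0 c)
two-type-count {c} {X} {Y} {p} perX perY gap gapXY gapYX {i} {j} i<j j<i+c Xi Yj with m≤n⇒∃[o]m+o≡n i<j
-- The two arcs have `l₁` and `l₂` interior positions.
... | l₁ , refl with m≤n⇒∃[o]m+o≡n j<i+c
... | l₂ , e = subst (λ m → (2 * p + 2 * m ≤ c + 2) × (2 ≤ m)) total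
    ( subst₂ _≤_ (sum-lhs p _ _) (trans (sum-rhs l₁ l₂) (cong (_+ 2) (sym c≡))) (s≤s (s≤s (+-mono-≤ arc₁ arc₂)))
    , subst (2 ≤_) (split (cnt M (i + 1) l₁) _) (m≤m+n 2 _))
  where
  M : ℕ → Bool
  M t = X t ∨ Y t
  M′ : ℕ → Bool
  M′ t = Y t ∨ X t
  perM : Periodic c M
  perM t = cong₂ _∨_ (perX t) (perY t)
  c≡ : c ≡ suc l₁ + suc l₂
  c≡ = +-cancelˡ-≡ i _ _ (trans (sym e) (shift i l₁ l₂))
    where
    shift : ∀ i l₁ l₂ → suc (suc i + l₁) + l₂ ≡ i + (suc l₁ + suc l₂)
    shift = solve-∀
  gap′ : Gap 2 M′ M′
  gap′ lt a b = gap lt (trans (Bool.∨-comm (X _) _) a) (trans (Bool.∨-comm (X _) _) b)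
  j+ : ∀ i l₁ → i + 1 + l₁ ≡ suc i + l₁
  j+ = solve-∀
  arc₁ : suc p + 2 * cnt M (i + 1) l₁ ≤ l₁ + 1
  arc₁ = arc-count gap gapXY l₁ i 0 Xi (subst (λ z → Y z ≡ true) (sym (j+ i l₁)) Yj)
  -- This arc leads from `Y` back to `X`, so the two types are exchanged.
  arc₂ : suc p + 2 * cnt M (suc i + l₁ + 1) l₂ ≤ l₂ + 1
  arc₂ = subst (λ m → suc p + 2 * m ≤ l₂ + 1) (cnt-cong (λ t → Bool.∨-comm (Y t) (X t)) _ l₂)
    (arc-count gap′ gapYX l₂ (suc i + l₁) 0 Yj
      (trans (cong X (trans (shift i l₁ l₂) (cong (i +_) (sym c≡)))) (trans (perX i) Xi)))
    where
    shift : ∀ i l₁ l₂ → suc i + l₁ + 1 + l₂ ≡ i + (suc l₁ + suc l₂)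
    shift = solve-∀
    cnt-cong : ∀ {P Q : ℕ → Bool} → (∀ t → P t ≡ Q t) → ∀ a L → cnt P a L ≡ cnt Q a L
    cnt-cong h a zero = refl
    cnt-cong h a (suc L) = cong₂ (λ b x → 𝟙 b + x) (h a) (cnt-cong h (suc a) L)
  split : ∀ x y → 2 + (x + y) ≡ suc x + suc y
  split = solve-∀
  total : suc (cnt M (i + 1) l₁) + suc (cnt M (suc i + l₁ + 1) l₂) ≡ cnt M 0 c
  total = begin
    suc (cnt M (i + 1) l₁) + suc (cnt M (suc i + l₁ + 1) l₂)
      ≡⟨ cong₂ (λ a b → suc (cnt M a l₁) + suc (cnt M b l₂)) (+-comm i 1) (trans (+-comm (suc i + l₁) 1)
          (cong suc (sym (+-suc i l₁)))) ⟩
    suc (cnt M (suc i) l₁) + suc (cnt M (suc (i + suc l₁)) l₂)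
      ≡⟨ cong₂ (λ a b → 𝟙 a + cnt M (suc i) l₁ + (𝟙 b + cnt M (suc (i + suc l₁)) l₂))
           (∨-trueˡ {b = Y i} Xi) (∨-trueʳ {X (i + suc l₁)} (subst (λ z → Y z ≡ true) (sym (+-suc i l₁)) Yj)) ⟨
    cnt M i (suc l₁) + cnt M (i + suc l₁) (suc l₂)  ≡⟨ cnt-+ M i (suc l₁) (suc l₂) ⟨
    cnt M i (suc l₁ + suc l₂)                       ≡⟨ cong (cnt M i) c≡ ⟨
    cnt M i c                                       ≡⟨ cnt-shift perM i ⟩
    cnt M 0 c                                       ∎
    where open ≡-Reasoning
  sum-lhs : ∀ p x y → 2 + (suc p + 2 * x + (suc p + 2 * y)) ≡ 2 * p + 2 * (suc x + suc y)
  sum-lhs = solve-∀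
  sum-rhs : ∀ x y → 2 + (x + 1 + (y + 1)) ≡ suc x + suc y + 2
  sum-rhs = solve-∀

half-≤ : ∀ {x k} → 2 * x ≤ 2 * k + 1 → x ≤ k
half-≤ {x} {k} h = s≤s⁻¹ (*-cancelˡ-< 2 x (suc k) (≤-trans (s≤s h) (≤-reflexive (eq k))))
  where
  eq : ∀ k → suc (2 * k + 1) ≡ 2 * suc k
  eq = solve-∀

-- With p + m = k + 2, the inequality (p + 1) m ≤ 2k + 3 amounts to (p - 1)(m - 2) ≤ 1.
two-gaps : ∀ {k p m} → 4 ≤ k → 2 ≤ p → 2 ≤ m → p + m ≡ k + 2 → suc p * m ≤ 2 * k + 3 → m ≤ 2 × p ≤ k
two-gaps {k} {p} {2} _ _ _ e _ = ≤-refl , ≤-reflexive (+-cancelʳ-≡ 2 p k e)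
two-gaps {m = 1} _ _ (s≤s ())
two-gaps {p = 1} _ (s≤s ())
-- With p = v + 2 and m = u + 3 the product is (v + 1)(u + 1), which forces u = v = 0, while k = u +
-- v + 3 is at least 4.
two-gaps {k} {suc (suc v)} {suc (suc (suc u))} 4≤k _ _ e h = ⊥-elim (<⇒≱ u+v>0 (≤-trans (m≤m+n (u + v)
    (u * v)) small))
  where
  k≡ : k ≡ u + v + 3
  k≡ = +-cancelʳ-≡ 2 k _ (trans (sym e) (eq u v))
    where
    eq : ∀ u v → suc (suc v) + suc (suc (suc u)) ≡ u + v + 3 + 2
    eq = solve-∀
  u+v>0 : 0 < u + v
  u+v>0 = +-cancelʳ-≤ 3 1 (u + v) (subst (4 ≤_) k≡ 4≤k)
  small : u + v + u * v ≤ 0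
  small = ≤-by-cancel _ _ (2 * u + 2 * v + 9) h (lhs u v) (trans (cong (λ z → 2 * z + 3) k≡) (rhs u v))
    where
    lhs : ∀ u v → suc (suc (suc v)) * suc (suc (suc u)) ≡ u + v + u * v + (2 * u + 2 * v + 9)
    lhs = solve-∀
    rhs : ∀ u v → 2 * (u + v + 3) + 3 ≡ 0 + (2 * u + 2 * v + 9)
    rhs = solve-∀

-- The total m satisfies p + m ≤ k + 2, so the lower bounds for `X` and `Y` force both to be the
-- whole union. Then every gap leads from `X` to `Y`, whence (p + 1) m ≤ c, and `two-gaps` applies.
two-type-bound : ∀ {c k X Y p} → Periodic c X → Periodic c Y →
  Gap 2 (λ i → X i ∨ Y i) (λ i → X i ∨ Y i) → Gap (suc p) X Y → Gap (suc p) Y X →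
  ∀ {i j} → i < j → j < i + c → X i ≡ true → Y j ≡ true →
  4 ≤ k → 2 ≤ p → c ≤ 2 * k + 3 → k + 2 ≤ p + cnt X 0 c → k + 2 ≤ p + cnt Y 0 c →
  cnt X 0 c ≤ 2 × p ≤ k
two-type-bound {c} {k} {X} {Y} {p} perX perY gap gapXY gapYX {i} {j} i<j j<i+c Xi Yj 4≤k 2≤p c≤ kX kY
  with two-type-count perX perY gap gapXY gapYX i<j j<i+c Xi Yj
... | total , 2≤m = subst (λ x → x ≤ 2 × p ≤ k) (≤-antisym m≤cX cX≤m)
                      (two-gaps 4≤k 2≤p 2≤m (≤-antisym p+m≤ (≤-trans kX (+-monoʳ-≤ p cX≤m))) sparse)
  where
  M : ℕ → Bool
  M t = X t ∨ Y t
  m = cnt M 0 c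
  perM : Periodic c M
  perM t = cong₂ _∨_ (perX t) (perY t)
  X⇒M : ∀ t → X t ≡ true → M t ≡ true
  X⇒M t = ∨-trueˡ
  Y⇒M : ∀ t → Y t ≡ true → M t ≡ true
  Y⇒M t = ∨-trueʳ
  p+m≤ : p + m ≤ k + 2
  p+m≤ = half-≤ (begin
    2 * (p + m)        ≡⟨ *-distribˡ-+ 2 p m ⟩
    2 * p + 2 * m      ≤⟨ total ⟩
    c + 2              ≤⟨ +-monoˡ-≤ 2 c≤ ⟩
    2 * k + 3 + 2      ≡⟨ eq k ⟩
    2 * (k + 2) + 1    ∎)
    where
    open ≤-Reasoning
    eq : ∀ k → 2 * k + 3 + 2 ≡ 2 * (k + 2) + 1
    eq = solve-∀
  cX≤m : cnt X 0 c ≤ m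
  cX≤m = cnt-mono X⇒M 0 c
  m≤cX : m ≤ cnt X 0 c
  m≤cX = +-cancelˡ-≤ p _ _ (≤-trans p+m≤ kX)
  m≤cY : m ≤ cnt Y 0 c
  m≤cY = +-cancelˡ-≤ p _ _ (≤-trans p+m≤ kY)
  c>0 : 1 ≤ c
  c>0 = +-cancelˡ-< i 0 c (subst (_< i + c) (sym (+-identityʳ i)) (<-trans i<j j<i+c))
  M⇒X : ∀ t → M t ≡ true → X t ≡ true
  M⇒X t = cnt-head X⇒M t c c>0 (trans (cnt-shift perX t) (trans (≤-antisym cX≤m m≤cX) (sym (cnt-shift perM t))))
  M⇒Y : ∀ t → M t ≡ true → Y t ≡ true
  M⇒Y t = cnt-head Y⇒M t c c>0 (trans (cnt-shift perY t) (trans (≤-antisym (cnt-mono Y⇒M 0 c) m≤cY) (sym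
      (cnt-shift perM t))))
  sparse : suc p * m ≤ 2 * k + 3
  sparse = ≤-trans (gap-count perM (λ lt a b → gapXY lt (M⇒X _ a) (M⇒Y _ b)) i (X⇒M i Xi)) c≤

-- Lists without repetition

Unique-resp-↭ : {A : Set} {xs ys : List A} → xs ↭ ys → Unique xs → Unique ys
Unique-resp-↭ {A} p = Permutation.Unique-resp-↭ (setoid A) (↭⇒↭ₛ p)

Unique-++⁻ : {A : Set} (xs : List A) {ys : List A} → Unique (xs ++ ys) →
  Unique xs × Unique ys × (∀ {v} → v ∈ xs → v ∉ ys)
Unique-++⁻ [] u = [] , u , λ ()
Unique-++⁻ (x ∷ xs) (x∉ ∷ u) with Unique-++⁻ xs u
... | ux , uy , d = (All.tabulate (λ v∈ → All.lookup x∉ (∈-++⁺ˡ v∈)) ∷ ux) , uy , d′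
  where
  d′ : ∀ {v} → v ∈ x ∷ xs → v ∉ _
  d′ (here refl) v∈ = All.lookup x∉ (∈-++⁺ʳ xs v∈) refl
  d′ (there p) = d p

lookup-injective : {A : Set} {xs : List A} → Unique xs → Injective _≡_ _≡_ (lookup xs)
lookup-injective (x∉ ∷ u) {Fin.zero} {Fin.zero} _ = refl
lookup-injective (x∉ ∷ u) {Fin.zero} {Fin.suc j} e = ⊥-elim (All.lookup x∉ (∈-lookup j) e)
lookup-injective (x∉ ∷ u) {Fin.suc i} {Fin.zero} e = ⊥-elim (All.lookup x∉ (∈-lookup i) (sym e))
lookup-injective (x∉ ∷ u) {Fin.suc i} {Fin.suc j} e = cong Fin.suc (lookup-injective u e)

-- Paths

module _ {n : ℕ} (G : Graph n) where

  infixr 5 _◂_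
  -- The vertex list is an index and distinctness is stated separately, so that cutting, reversing
  -- and joining paths become operations on lists.
  data Trail : Fin n → Fin n → List (Fin n) → Set where
    stop : ∀ {x} → Trail x x [ x ]
    _◂_  : ∀ {x y z l} → adj G x y ≡ true → Trail y z l → Trail x z (x ∷ l)

  adj-flip : ∀ {x y} → adj G x y ≡ true → adj G y x ≡ true
  adj-flip {x} {y} e = trans (adj-sym G y x) e

  adj-≢ : ∀ {x y} → adj G x y ≡ true → x ≢ y
  adj-≢ {x} e refl with () ← trans (sym e) (adj-irr G x)

module _ {n : ℕ} {G : Graph n} where

  trail-++ : ∀ {x y x′ y′ l l′} → Trail G x y l → adj G y x′ ≡ true → Trail G x′ y′ l′ → Trail G x y′ (l ++ l′)
  trail-++ stop e t = e ◂ t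
  trail-++ (f ◂ s) e t = f ◂ trail-++ s e t

  trail-reverse : ∀ {x y l} → Trail G x y l → Trail G y x (reverse l)
  trail-reverse stop = stop
  trail-reverse {x} {l = _ ∷ l} (e ◂ t) rewrite unfold-reverse x l = trail-++ (trail-reverse t) (adj-flip G e) stop

  trail-start∈ : ∀ {x y l} → Trail G x y l → x ∈ l
  trail-start∈ stop = here refl
  trail-start∈ (_ ◂ _) = here refl

  trail-end∈ : ∀ {x y l} → Trail G x y l → y ∈ l
  trail-end∈ stop = here refl
  trail-end∈ (_ ◂ t) = there (trail-end∈ t)

  trail-head : ∀ {x y v l} → Trail G x y (v ∷ l) → x ≡ v
  trail-head stop = refl
  trail-head (_ ◂ _) = refl

  trail-split : ∀ {x y v} as {bs} → Trail G x y (as ++ v ∷ bs) → Trail G x v (as ++ [ v ]) × Trail G v y (v ∷ bs)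
  trail-split [] t with trail-head t
  ... | refl = stop , t
  trail-split (a ∷ []) (e ◂ t) with trail-head t
  ... | refl = (e ◂ stop) , t
  trail-split (a ∷ a′ ∷ as) (e ◂ t) with trail-split (a′ ∷ as) t
  ... | t₁ , t₂ = (e ◂ t₁) , t₂

  trail-split₂ : ∀ {x y u v} as {bs} → Trail G x y (as ++ u ∷ v ∷ bs) →
    Trail G x u (as ++ [ u ]) × adj G u v ≡ true × Trail G v y (v ∷ bs)
  trail-split₂ as t with trail-split as t
  ... | t₁ , (e ◂ t₂) with trail-head t₂
  ... | refl = t₁ , e , t₂

  trail-nonempty : ∀ {x y l} → Trail G x y l → 1 ≤ length l
  trail-nonempty stop = s≤s z≤n
  trail-nonempty (_ ◂ _) = s≤s z≤n

  trail-cycle : ∀ {x y l} → Trail G x y l → adj G y x ≡ true → Unique l → 3 ≤ length l →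
    IsCycle G (length l) (lookup l)
  trail-cycle {x} {y} {l} t e u 3≤ = 3≤ , lookup-injective u , edges
    where
    consecutive : ∀ {x y l} → Trail G x y l → (i j : Fin (length l)) → suc (toℕ i) ≡ toℕ j →
      adj G (lookup l i) (lookup l j) ≡ true
    consecutive stop Fin.zero Fin.zero ()
    consecutive (e ◂ stop) Fin.zero (Fin.suc Fin.zero) _ = e
    consecutive (e ◂ (_ ◂ _)) Fin.zero (Fin.suc Fin.zero) _ = e
    consecutive (e ◂ t) (Fin.suc i) (Fin.suc j) p = consecutive t i j (suc-injective p)
    last : ∀ {x y l} → Trail G x y l → (i : Fin (length l)) → suc (toℕ i) ≡ length l → lookup l i ≡ y
    last stop Fin.zero _ = refl
    last (e ◂ stop) (Fin.suc Fin.zero) _ = refl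
    last (e ◂ t@(_ ◂ _)) (Fin.suc i) p = last t i (suc-injective p)
    first : ∀ {x y l} → Trail G x y l → (i : Fin (length l)) → toℕ i ≡ 0 → lookup l i ≡ x
    first stop Fin.zero _ = refl
    first (e ◂ t) Fin.zero _ = refl
    edges : ∀ i j → (suc (toℕ i) ≡ toℕ j ⊎ (suc (toℕ i) ≡ length l × toℕ j ≡ 0)) →
      adj G (lookup l i) (lookup l j) ≡ true
    edges i j (inj₁ p) = consecutive t i j p
    edges i j (inj₂ (p , q)) rewrite last t i p | first t j q = e

-- Longest cycles

module LongestCycle {n : ℕ} (G : Graph n) {c : ℕ} (C : Fin c → Fin n) (long : IsLongestCycle G c C) where

  Outside : Fin n → Set
  Outside v = onCycle C v ≡ false

  cycle-bound : ∀ {x y l} → Trail G x y l → adj G y x ≡ true → Unique l → 3 ≤ length l → length l ≤ c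
  cycle-bound t e u 3≤ = proj₂ long _ _ (trail-cycle t e u 3≤)

  3≤c : 3 ≤ c
  3≤c = proj₁ (proj₁ long)

  C-injective : Injective _≡_ _≡_ C
  C-injective = proj₁ (proj₂ (proj₁ long))

  instance
    c≢0 : NonZero c
    c≢0 = >-nonZero (<-≤-trans z<s 3≤c)

  cyc : ℕ → Fin n
  cyc i = C (i mod c)

  cyc-cong : ∀ {i j} → i % c ≡ j % c → cyc i ≡ cyc j
  cyc-cong {i} {j} e = cong C (Fin.fromℕ<-cong _ _ e (m%n<n i c) (m%n<n j c))

  cyc-periodic : ∀ i → cyc (i + c) ≡ cyc i
  cyc-periodic i = cyc-cong {i + c} ([m+n]%n≡m%n i c)

  cyc-toℕ : ∀ i → cyc (toℕ i) ≡ C i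
  cyc-toℕ i = cong C (trans (Fin.fromℕ<-cong _ _ (m<n⇒m%n≡m (Fin.toℕ<n i)) (m%n<n (toℕ i) c) (Fin.toℕ<n i))
      (Fin.fromℕ<-toℕ i (Fin.toℕ<n i)))

  toℕ-mod : ∀ i → toℕ (i mod c) ≡ i % c
  toℕ-mod i = Fin.toℕ-fromℕ< (m%n<n i c)

  suc-% : ∀ i → suc i % c ≡ suc (i % c) % c
  suc-% i = trans (cong (λ z → suc z % c) (m≡m%n+[m/n]*n i c)) ([m+kn]%n≡m%n (suc (i % c)) (i / c) c)

  cyc-adj : ∀ i → adj G (cyc i) (cyc (suc i)) ≡ true
  cyc-adj i = proj₂ (proj₂ (proj₁ long)) (i mod c) (suc i mod c) next
    where
    next : suc (toℕ (i mod c)) ≡ toℕ (suc i mod c) ⊎ (suc (toℕ (i mod c)) ≡ c × toℕ (suc i mod c) ≡ 0)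
    next rewrite toℕ-mod i | toℕ-mod (suc i) | suc-% i with m≤n⇒m<n∨m≡n (m%n<n i c)
    ... | inj₁ lt = inj₁ (sym (m<n⇒m%n≡m lt))
    ... | inj₂ eq = inj₂ (eq , trans (cong (_% c) eq) (n%n≡0 c))

  -- Equal vertices have positions with equal remainders by injectivity of `C`; then the quotients
  -- differ, and the positions are at least `c` apart.
  cyc-distinct : ∀ {i j} → i < j → j < i + c → cyc i ≢ cyc j
  cyc-distinct {i} {j} i<j j<i+c e = <⇒≱ j<i+c (begin
    i + c                        ≡⟨ cong (_+ c) (m≡m%n+[m/n]*n i c) ⟩
    i % c + i / c * c + c        ≡⟨ eq (i % c) (i / c) c ⟩
    i % c + suc (i / c) * c      ≤⟨ +-monoʳ-≤ (i % c) (*-monoˡ-≤ c q<) ⟩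
    i % c + j / c * c            ≡⟨ cong (_+ j / c * c) r≡ ⟩
    j % c + j / c * c            ≡⟨ m≡m%n+[m/n]*n j c ⟨
    j                            ∎)
    where
    open ≤-Reasoning
    eq : ∀ r q c → r + q * c + c ≡ r + suc q * c
    eq = solve-∀
    r≡ : i % c ≡ j % c
    r≡ = trans (sym (toℕ-mod i)) (trans (cong toℕ (C-injective e)) (toℕ-mod j))
    q< : i / c < j / c
    q< = *-cancelʳ-< c _ _ (+-cancelˡ-< (i % c) _ _ (subst₂ _<_ (m≡m%n+[m/n]*n i c)
           (trans (m≡m%n+[m/n]*n j c) (cong (_+ j / c * c) (sym r≡))) i<j))

  cyc-onCycle : ∀ i → onCycle C (cyc i) ≡ true
  cyc-onCycle i = onCycle⁺ C (i mod c) refl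

  arc : ℕ → ℕ → List (Fin n)
  arc a zero = [ cyc a ]
  arc a (suc L) = cyc a ∷ arc (suc a) L

  length-arc : ∀ a L → length (arc a L) ≡ suc L
  length-arc a zero = refl
  length-arc a (suc L) = cong suc (length-arc (suc a) L)

  arc-trail : ∀ a L → Trail G (cyc a) (cyc (a + L)) (arc a L)
  arc-trail a zero rewrite +-identityʳ a = stop
  arc-trail a (suc L) rewrite +-suc a L = cyc-adj a ◂ arc-trail (suc a) L

  ∈-arc : ∀ {v} a L → v ∈ arc a L → ∃ λ t → t ≤ L × v ≡ cyc (a + t)
  ∈-arc a zero (here e) = 0 , z≤n , trans e (cong cyc (sym (+-identityʳ a)))
  ∈-arc a (suc L) (here e) = 0 , z≤n , trans e (cong cyc (sym (+-identityʳ a)))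
  ∈-arc a (suc L) (there p) with ∈-arc (suc a) L p
  ... | t , t≤ , e = suc t , s≤s t≤ , trans e (cong cyc (sym (+-suc a t)))

  arc-unique : ∀ a L → L < c → Unique (arc a L)
  arc-unique a zero _ = [] ∷ []
  arc-unique a (suc L) L< = All.tabulate distinct ∷ arc-unique (suc a) L (<-trans (n<1+n L) L<)
    where
    distinct : ∀ {v} → v ∈ arc (suc a) L → cyc a ≢ v
    distinct v∈ e with ∈-arc (suc a) L v∈
    ... | t , t≤ , refl = cyc-distinct (s≤s (m≤m+n a t)) (subst (_< a + c) (+-suc a t) (+-monoʳ-< a
        (≤-<-trans (s≤s t≤) L<))) e

  -- Replacing the arc between positions i and j by the path l must not lengthen the cycle.
  ear : ∀ {i j x y l} → i < j → j < i + c → Trail G x y l → Unique l → All Outside l →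
    adj G (cyc i) x ≡ true → adj G y (cyc j) ≡ true → i + suc (length l) ≤ j
  ear {i} {j} {x} {y} {l} i<j j<i+c t u out e f with m≤n⇒∃[o]m+o≡n i<j
  -- The path replaces the `o` positions strictly between `i` and `j`; the arc kept, from `j` on to
  -- `i + c`, has `o′ + 2` vertices.
  ... | o , refl with m≤n⇒∃[o]m+o≡n j<i+c
  ... | o′ , e′ = subst (_≤ suc i + o) (sym (+-suc i (length l))) (s≤s (+-monoʳ-≤ i
      (≤-by-cancel (length l) o (suc (suc o′)) bound (trans len (+-comm (suc (suc o′)) _)) c≡)))
    where
    j₀ : ℕ
    j₀ = suc i + o
    c≡ : c ≡ o + suc (suc o′)
    c≡ = +-cancelˡ-≡ i _ _ (trans (sym e′) (shift i o o′))
      where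
      shift : ∀ i o o′ → suc (suc i + o) + o′ ≡ i + (o + suc (suc o′))
      shift = solve-∀
    len : length (arc j₀ (suc o′) ++ l) ≡ suc (suc o′) + length l
    len = trans (length-++ (arc j₀ (suc o′))) (cong (_+ length l) (length-arc j₀ (suc o′)))
    back : cyc (j₀ + suc o′) ≡ cyc i
    back = trans (cong cyc (trans (+-suc j₀ o′) e′)) (cyc-periodic i)
    bound : length (arc j₀ (suc o′) ++ l) ≤ c
    bound = cycle-bound (trail-++ (subst (λ z → Trail G (cyc j₀) z (arc j₀ (suc o′))) back (arc-trail j₀
        (suc o′))) e t) f
      (Unique.++⁺ (arc-unique j₀ (suc o′) (subst (suc o′ <_) (sym c≡) (m≤n+m (suc (suc o′)) o))) u disjoint)
      (subst (3 ≤_) (sym len) (≤-trans (s≤s (s≤s (s≤s z≤n))) (+-mono-≤ (s≤s (s≤s (z≤n {o′}))) (trail-nonempty t))))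
      where
      disjoint : ∀ {v} → v ∈ arc j₀ (suc o′) × v ∈ l → ⊥
      disjoint (v∈ , v∈l) with ∈-arc j₀ (suc o′) v∈
      ... | s , _ , refl with () ← trans (sym (cyc-onCycle (j₀ + s))) (All.lookup out v∈l)

Disjoint : {A : Set} → List A → List A → Set
Disjoint l m = ∀ {v} → v ∈ l → v ∉ m

Disjoint-sym : {A : Set} {l m : List A} → Disjoint l m → Disjoint m l
Disjoint-sym d p q = d q p

_∈?_ : ∀ {n} (v : Fin n) (l : List (Fin n)) → Dec (v ∈ l)
_∈?_ = Data.List.Membership.DecPropositional._∈?_ Fin._≟_

-- Disjoint paths in 2-connected graphs

module DisjointPaths {n : ℕ} (G : Graph n) (connected : Connected G) (connectedMinus : ∀ v → ConnectedMinus G v)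
  (ks : List (Fin n)) {κ₁ κ₂ : Fin n} (κ₁∈ : κ₁ ∈ ks) (κ₂∈ : κ₂ ∈ ks) (κ₁≢κ₂ : κ₁ ≢ κ₂) where

  -- The side conditions exclude repetitions and let the path meet `ks` only in its last vertex.
  data PathTo : Fin n → List (Fin n) → Set where
    arrive : ∀ {x} → x ∈ ks → PathTo x [ x ]
    step   : ∀ {x y l} → x ∉ ks → adj G x y ≡ true → x ∉ l → PathTo y l → PathTo x (x ∷ l)

  suffix : ∀ {x z l} → PathTo x l → z ∈ l → ∃ λ l′ → PathTo z l′ × (∀ {v} → v ∈ l′ → v ∈ l)
  suffix p@(arrive _) (here refl) = _ , p , λ q → q
  suffix p@(step _ _ _ _) (here refl) = _ , p , λ q → q
  suffix (step _ _ _ p) (there z∈) with suffix p z∈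
  ... | l′ , p′ , sub = l′ , p′ , there ∘ sub

  path-start : ∀ {x l} → PathTo x l → x ∈ l
  path-start (arrive _) = here refl
  path-start (step _ _ _ _) = here refl

  -- Prepending `x` must not spoil the path: it stops at once if `x` is in `ks`, and is shortened to
  -- its part from `x` on if it already visits `x`.
  path-cons : ∀ {x y l} → adj G x y ≡ true → PathTo y l →
    ∃ λ l′ → PathTo x l′ × (∀ {v} → v ∈ l′ → v ≡ x ⊎ v ∈ l)
  path-cons {x} {l = l} e p with x ∈? ks | x ∈? l
  ... | yes x∈ | _ = [ x ] , arrive x∈ , λ { (here refl) → inj₁ refl }
  ... | no x∉ | no x∉l = x ∷ l , step x∉ e x∉l p , λ { (here refl) → inj₁ refl ; (there q) → inj₂ q }
  ... | no x∉ | yes x∈l with suffix p x∈l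
  ... | l′ , p′ , sub = l′ , p′ , inj₂ ∘ sub

  Pair : Fin n → Fin n → Set
  Pair u w = ∃₂ λ l m → PathTo u l × PathTo w m × Disjoint l m

  Pair-sym : ∀ {u w} → Pair u w → Pair w u
  Pair-sym (l , m , p , q , d) = m , l , q , p , Disjoint-sym d

  -- Two paths from `w` to `ks` that share only `w`, each stored from its second vertex on.
  record Fan (w : Fin n) : Set where
    field
      {a b} : Fin n
      {l m} : List (Fin n)
      adj-a : adj G w a ≡ true
      adj-b : adj G w b ≡ true
      path-a : PathTo a l
      path-b : PathTo b m
      disjoint : Disjoint l m
      w∉l : w ∉ l
      w∉m : w ∉ m

  path-avoiding : ∀ {w u κ} → Walk G (_≢ w) u κ → κ ∈ ks → ∃ λ l → PathTo u l × w ∉ l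
  path-avoiding (nil u≢w) κ∈ = _ , arrive κ∈ , λ { (here refl) → u≢w refl }
  path-avoiding (cons u≢w e walk) κ∈ with path-avoiding walk κ∈
  ... | l , p , w∉ with path-cons e p
  ... | l′ , p′ , sub = l′ , p′ , λ w∈ → case-⊎ (sub w∈)
    where
    case-⊎ : _ ≡ _ ⊎ _ ∈ l → ⊥
    case-⊎ (inj₁ e) = u≢w (sym e)
    case-⊎ (inj₂ w∈) = w∉ w∈

  -- The walk is followed up to its first vertex on the fan, and from there along the fan.
  link : ∀ {w} (F : Fan w) {u κ} → Walk G (_≢ w) u κ → κ ∈ ks →
    ∃ λ l → PathTo u l × w ∉ l × (Disjoint l (Fan.l F) ⊎ Disjoint l (Fan.m F))
  link {w} F {u} walk κ∈ with u ∈? Fan.l F | u ∈? Fan.m F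
  ... | yes u∈ | _ with suffix (Fan.path-a F) u∈
  ... | l′ , p , sub = l′ , p , (λ w∈ → Fan.w∉l F (sub w∈)) , inj₂ (λ v∈ → Fan.disjoint F (sub v∈))
  link {w} F {u} walk κ∈ | no _ | yes u∈ with suffix (Fan.path-b F) u∈
  ... | l′ , p , sub = l′ , p , (λ w∈ → Fan.w∉m F (sub w∈)) , inj₁ (λ v∈ v∈l → Fan.disjoint F v∈l (sub v∈))
  link {w} F {u} (nil u≢w) κ∈ | no u∉ | no _ = [ u ] , arrive κ∈ , (λ { (here refl) → u≢w refl }) , inj₁
      (λ { (here refl) → u∉ })
  link {w} F {u} (cons u≢w e walk) κ∈ | no u∉l | no u∉m with link F walk κ∈
  ... | l , p , w∉ , d with path-cons e p
  ... | l′ , p′ , sub = l′ , p′ , avoid , split d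
    where
    avoid : w ∉ l′
    avoid w∈ with sub w∈
    ... | inj₁ refl = u≢w refl
    ... | inj₂ q = w∉ q
    extend : ∀ {m} → u ∉ m → Disjoint l m → Disjoint l′ m
    extend u∉ d v∈ with sub v∈
    ... | inj₁ refl = u∉
    ... | inj₂ q = d q
    split : Disjoint l (Fan.l F) ⊎ Disjoint l (Fan.m F) → Disjoint l′ (Fan.l F) ⊎ Disjoint l′ (Fan.m F)
    split (inj₁ d) = inj₁ (extend u∉l d)
    split (inj₂ d) = inj₂ (extend u∉m d)

  -- The invariant carried along a walk: just enough to join `w` and any other vertex to `ks` by
  -- disjoint paths.
  State : Fin n → Set
  State w = w ∈ ks ⊎ (w ∉ ks × Fan w)

  -- If `w` is in `ks`, a path from `u` that avoids `w` is disjoint from the trivial path at `w`.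
  -- Otherwise a path from `u` in the graph without `w` can be chosen to miss one branch of the fan,
  -- and `w` uses that branch.
  pair-of-state : ∀ {w u} → State w → u ≢ w → Pair u w
  pair-of-state {w} {u} (inj₁ w∈) u≢w = via κ-other
    where
    κ-other : ∃ λ κ → κ ∈ ks × κ ≢ w
    κ-other with κ₁ Fin.≟ w
    ... | yes refl = κ₂ , κ₂∈ , (κ₁≢κ₂ ∘ sym)
    ... | no κ₁≢ = κ₁ , κ₁∈ , κ₁≢
    via : (∃ λ κ → κ ∈ ks × κ ≢ w) → Pair u w
    via (κ , κ∈ , κ≢) with path-avoiding (connectedMinus w u κ u≢w κ≢) κ∈
    ... | l , p , w∉ = l , [ w ] , p , arrive w∈ , λ { v∈ (here refl) → w∉ v∈ }
  pair-of-state {w} {u} (inj₂ (w∉ , F)) u≢w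
    with link F (connectedMinus w u κ₁ u≢w (λ { refl → w∉ κ₁∈ })) κ₁∈
  ... | l , p , w∉l , inj₁ d = l , _ , p , step w∉ (Fan.adj-a F) (Fan.w∉l F) (Fan.path-a F) ,
        λ { v∈ (here refl) → w∉l v∈ ; v∈ (there q) → d v∈ q }
  ... | l , p , w∉l , inj₂ d = l , _ , p , step w∉ (Fan.adj-b F) (Fan.w∉m F) (Fan.path-b F) ,
        λ { v∈ (here refl) → w∉l v∈ ; v∈ (there q) → d v∈ q }

  -- As `w` is not in `ks`, its path has a second vertex; the branches start there and at `u`.
  fan-of-pair : ∀ {u w} → Pair u w → adj G w u ≡ true → w ∉ ks → Fan w
  fan-of-pair (l , _ , p , arrive w∈ , d) e w∉ = ⊥-elim (w∉ w∈)
  fan-of-pair (l , _ , p , step _ f w∉m q , d) e w∉ = record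
    { adj-a = e ; adj-b = f ; path-a = p ; path-b = q
    ; disjoint = λ v∈ v∈m → d v∈ (there v∈m) ; w∉l = λ w∈ → d w∈ (here refl) ; w∉m = w∉m }

  -- This is Menger's theorem for two paths, by induction along a walk: the state at `v` gives
  -- disjoint paths from `v` and from its neighbour `y`, and these form a fan at `y`.
  state-along : ∀ {ok v w} → State v → Walk G ok v w → State w
  state-along s (nil _) = s
  state-along {v = v} s (cons {y = y} _ e walk) = state-along next walk
    where
    next : State y
    next with y ∈? ks
    ... | yes y∈ = inj₁ y∈
    ... | no y∉ = inj₂ (y∉ , fan-of-pair (Pair-sym (pair-of-state s (adj-≢ G e ∘ sym))) (adj-flip G e) y∉)

  pair : ∀ {u w} → u ≢ w → Pair u w
  pair {u} {w} = pair-of-state (state-along (inj₁ κ₁∈) (connected κ₁ w))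

  path-trail : ∀ {x l} → PathTo x l →
    ∃ λ κ → κ ∈ ks × Trail G x κ l × Unique l × (∀ {v} → v ∈ l → v ∈ ks → v ≡ κ)
  path-trail (arrive x∈) = _ , x∈ , stop , ([] ∷ []) , λ { (here refl) _ → refl }
  path-trail (step {x} {l = l} x∉ e x∉l p) with path-trail p
  ... | κ , κ∈ , t , u , only = κ , κ∈ , e ◂ t , (All.tabulate (λ { v∈ refl → x∉l v∈ }) ∷ u) ,
        λ { (here refl) v∈ → ⊥-elim (x∉ v∈) ; (there p) → only p }

  -- Applied with `p` as membership in the longest cycle: cutting after the last vertex `γ` on it
  -- leaves a path that stays outside.
  trim : ∀ {p : Fin n → Bool} → (∀ {v} → v ∈ ks → p v ≡ false) → ∀ {x l} → PathTo x l →
    All (λ v → p v ≡ false) l ⊎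
    (∃₂ λ γ a → ∃ λ l′ → p γ ≡ true × γ ∈ l × adj G γ a ≡ true × PathTo a l′ ×
       (∀ {v} → v ∈ l′ → v ∈ l) × All (λ v → p v ≡ false) l′)
  trim out (arrive x∈) = inj₁ (out x∈ ∷ [])
  trim {p} out (step {x} {y} {l} x∉ e x∉l q) with trim out q | p x in px
  ... | inj₂ (γ , a , l′ , pγ , γ∈ , f , q′ , sub , none) | _ = inj₂
      (γ , a , l′ , pγ , there γ∈ , f , q′ , there ∘ sub , none)
  ... | inj₁ none | false = inj₁ (px ∷ none)
  ... | inj₁ none | true = inj₂ (x , y , l , px , here refl , e , q , there , none)

-- Arcs of a cycle

module _ {n : ℕ} {G : Graph n} where

  trail-join : ∀ {x κ y l m} → Trail G x κ l → Trail G κ y (κ ∷ m) → Trail G x y (l ++ m)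
  trail-join stop t = t
  trail-join (e ◂ s) t = e ◂ trail-join s t

  trail-uncons : ∀ {x y l} → Trail G x y l → ∃ λ m → l ≡ x ∷ m
  trail-uncons stop = _ , refl
  trail-uncons (_ ◂ _) = _ , refl

Unique-reverse : {A : Set} {l : List A} → Unique l → Unique (reverse l)
Unique-reverse {l = l} = Unique-resp-↭ (↭-sym (↭-reverse l))

∈-reverse⁻ : {A : Set} {v : A} {l : List A} → v ∈ reverse l → v ∈ l
∈-reverse⁻ = Any.reverse⁻

module _ {n : ℕ} {G : Graph n} {x y : Fin n} {ks : List (Fin n)} (t : Trail G x y ks) (e : adj G y x ≡ true)
  (u : Unique ks) where

  LongArc : Fin n → Fin n → Set
  LongArc κ κ′ = ∃ λ W → Trail G κ κ′ W × Unique W × (∀ {v} → v ∈ W → v ∈ ks) × length ks + 2 ≤ 2 * length W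

  LongArc-sym : ∀ {κ κ′} → LongArc κ κ′ → LongArc κ′ κ
  LongArc-sym (W , t , u , sub , len) = reverse W , trail-reverse t , Unique-reverse u , (λ v∈ → sub
      (∈-reverse⁻ v∈)) ,
    subst (λ z → length ks + 2 ≤ 2 * z) (sym (length-reverse W)) len

  -- The two arcs between `κ` and `κ′` share just these ends, so their vertex numbers add up to
  -- `length ks + 2`, and the longer arc has at least half of that.
  long-arc-ordered : ∀ as {κ κ′} ms {bs} → ks ≡ as ++ κ ∷ ms ++ κ′ ∷ bs → LongArc κ κ′
  long-arc-ordered as {κ} {κ′} ms {bs} refl = longer (≤-total (length outer) (length inner))
    where
    inner outer : List (Fin n)
    inner = κ ∷ ms ++ [ κ′ ]
    outer = reverse (as ++ [ κ ]) ++ reverse (κ′ ∷ bs)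

    after : Trail G κ y (κ ∷ ms ++ κ′ ∷ bs)
    after = proj₂ (trail-split as t)
    inner-trail : Trail G κ κ′ inner
    inner-trail = proj₁ (trail-split (κ ∷ ms) after)
    -- From `κ` back to `x`, over the closing edge to `y`, and back to `κ′`.
    outer-trail : Trail G κ κ′ outer
    outer-trail = trail-++ (trail-reverse (proj₁ (trail-split as t))) (adj-flip G e)
                    (trail-reverse (proj₂ (trail-split (κ ∷ ms) after)))

    regroup : ks ≡ as ++ inner ++ bs
    regroup = cong (λ l → as ++ κ ∷ l) (sym (++-assoc ms [ κ′ ] bs))
    inner-unique : Unique inner
    inner-unique = proj₁ (Unique-++⁻ inner (proj₁ (proj₂ (Unique-++⁻ as (subst Unique regroup u)))))
    regroup′ : ks ↭ ms ++ (as ++ [ κ ]) ++ κ′ ∷ bs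
    regroup′ = begin
      as ++ κ ∷ ms ++ κ′ ∷ bs           ≡⟨ ++-assoc as [ κ ] _ ⟨
      (as ++ [ κ ]) ++ ms ++ κ′ ∷ bs    ↭⟨ shifts (as ++ [ κ ]) ms ⟩
      ms ++ (as ++ [ κ ]) ++ κ′ ∷ bs    ∎
      where open PermutationReasoning
    outer-↭ : outer ↭ (as ++ [ κ ]) ++ κ′ ∷ bs
    outer-↭ = ++⁺ (↭-reverse (as ++ [ κ ])) (↭-reverse (κ′ ∷ bs))
    outer-unique : Unique outer
    outer-unique = Unique-resp-↭ (↭-sym outer-↭) (proj₁ (proj₂ (Unique-++⁻ ms (Unique-resp-↭ regroup′ u))))

    length-sum : length ks + 2 ≡ length inner + length outer
    length-sum rewrite ↭-length outer-↭ | ↭-length regroup′ | length-++ ms {(as ++ [ κ ]) ++ κ′ ∷ bs} | length-++ ms {[ κ′ ]} =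
      eq (length ms) (length ((as ++ [ κ ]) ++ κ′ ∷ bs))
      where
      eq : ∀ a b → a + b + 2 ≡ suc (a + 1) + b
      eq = solve-∀

    longer : length outer ≤ length inner ⊎ length inner ≤ length outer → LongArc κ κ′
    longer (inj₁ le) = inner , inner-trail , inner-unique ,
      (λ v∈ → subst (_ ∈_) (sym regroup) (∈-++⁺ʳ as (∈-++⁺ˡ v∈))) , (begin
        length ks + 2                     ≡⟨ length-sum ⟩
        length inner + length outer       ≤⟨ +-monoʳ-≤ (length inner) le ⟩
        length inner + length inner       ≡⟨ cong (length inner +_) (+-identityʳ _) ⟨
        2 * length inner                  ∎)
      where open ≤-Reasoning
    longer (inj₂ le) = outer , outer-trail , outer-unique ,
      (λ v∈ → ∈-resp-↭ (↭-sym regroup′) (∈-++⁺ʳ ms (∈-resp-↭ outer-↭ v∈))) , (begin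
        length ks + 2                     ≡⟨ length-sum ⟩
        length inner + length outer       ≤⟨ +-monoˡ-≤ (length outer) le ⟩
        length outer + length outer       ≡⟨ cong (length outer +_) (+-identityʳ _) ⟨
        2 * length outer                  ∎)
      where open ≤-Reasoning

  long-arc : ∀ {κ κ′} → κ ∈ ks → κ′ ∈ ks → κ ≢ κ′ → LongArc κ κ′
  long-arc {κ} {κ′} κ∈ κ′∈ κ≢κ′ with ∈-∃++ κ∈
  ... | as , ds , refl with ∈-++⁻ as κ′∈
  ... | inj₂ (here refl) = ⊥-elim (κ≢κ′ refl)
  ... | inj₂ (there κ′∈ds) with ∈-∃++ κ′∈ds
  ... | ms , bs , refl = long-arc-ordered as ms refl
  long-arc {κ} {κ′} κ∈ κ′∈ κ≢κ′ | as , ds , refl | inj₁ κ′∈as with ∈-∃++ κ′∈as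
  ... | as′ , ms , refl = LongArc-sym (long-arc-ordered as′ ms (++-assoc as′ (κ′ ∷ ms) (κ ∷ ds)))

-- Cycles outside the longest cycle

module TwoConnected {n : ℕ} (G : Graph n) {c : ℕ} (C : Fin c → Fin n) (long : IsLongestCycle G c C)
  (connected : Connected G) (connectedMinus : ∀ v → ConnectedMinus G v) {k : ℕ} (c≤ : c ≤ 2 * k + 3) where

  open LongestCycle G C long

  on-off : ∀ {u v} → onCycle C u ≡ true → Outside v → u ≢ v
  on-off on off refl with () ← trans (sym on) off

  cyc-surjective : ∀ {γ} → onCycle C γ ≡ true → ∃ λ i → i < c × cyc i ≡ γ
  cyc-surjective {γ} on with onCycle⁻ C γ on
  ... | i , refl = toℕ i , Fin.toℕ<n i , cyc-toℕ i

  -- `ear` bounds both arcs between the attachments from below, the second one with the path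
  -- reversed and `i` moved one turn on; the arc lengths add up to `c`.
  ear-both-< : ∀ {i j x y l} → i < j → j < c → Trail G x y l → Unique l → All Outside l →
    adj G (cyc i) x ≡ true → adj G y (cyc j) ≡ true → 2 * suc (length l) ≤ c
  ear-both-< {i} {j} {x} {y} {l} i<j j<c t u out e f = ≤-by-cancel _ _ (i + j) (+-mono-≤ forward backward)
      (eq i (suc (length l)) j) (eq′ i j c)
    where
    forward : i + suc (length l) ≤ j
    forward = ear i<j (≤-trans j<c (m≤n+m c i)) t u out e f
    backward : j + suc (length l) ≤ i + c
    backward = subst (λ z → j + suc z ≤ i + c) (length-reverse l)
      (ear (≤-trans j<c (m≤n+m c i)) (+-monoˡ-< c i<j) (trail-reverse t) (Unique-reverse u)
        (All.tabulate (λ v∈ → All.lookup out (∈-reverse⁻ v∈)))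
        (adj-flip G f) (subst (λ z → adj G x z ≡ true) (sym (cyc-periodic i)) (adj-flip G e)))
    eq : ∀ i s j → i + s + (j + s) ≡ 2 * s + (i + j)
    eq = solve-∀
    eq′ : ∀ i j c → j + (i + c) ≡ c + (i + j)
    eq′ = solve-∀

  ear-both : ∀ {γ γ′ x y l} → onCycle C γ ≡ true → onCycle C γ′ ≡ true → γ ≢ γ′ →
    Trail G x y l → Unique l → All Outside l → adj G γ x ≡ true → adj G y γ′ ≡ true → 2 * suc (length l) ≤ c
  ear-both {l = l} on on′ γ≢γ′ t u out e f with cyc-surjective on | cyc-surjective on′
  ... | i , i< , refl | j , j< , refl with <-cmp i j
  ... | tri< i<j _ _ = ear-both-< i<j j< t u out e f
  ... | tri≈ _ refl _ = ⊥-elim (γ≢γ′ refl)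
  ... | tri> _ _ j<i = subst (λ z → 2 * suc z ≤ c) (length-reverse l)
    (ear-both-< j<i i< (trail-reverse t) (Unique-reverse u) (All.tabulate (λ v∈ → All.lookup out (∈-reverse⁻ v∈)))
      (adj-flip G f) (adj-flip G e))

  half-c : ∀ {s} → 2 * suc s ≤ c → s ≤ k
  half-c {s} h = s≤s⁻¹ (half-≤ (≤-trans (≤-trans h c≤) (≤-reflexive (eq k))))
    where
    eq : ∀ k → 2 * k + 3 ≡ 2 * suc k + 1
    eq = solve-∀

  -- Two disjoint paths join the longest cycle to `ks`. Together with the longer arc W of `ks`
  -- between their feet they form an ear with at least |W| vertices, so |W| ≤ k by `ear-both`, while
  -- 2|W| is at least `length ks + 2`.
  outside-cycle-bound : ∀ {x y ks} → Trail G x y ks → adj G y x ≡ true → Unique ks → All Outside ks → length ks + 2 ≤ 2 * k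
  outside-cycle-bound {x} {y} {ks} t e uks out = conclude (pair (cyc-distinct z<s (≤-trans (s≤s (s≤s z≤n)) 3≤c)))
    where
    open DisjointPaths G connected connectedMinus ks (trail-end∈ t) (trail-start∈ t) (adj-≢ G e)
    ks-out : ∀ {v} → v ∈ ks → Outside v
    ks-out = All.lookup out

    -- The list `l` omits the attachment `γ` but includes the foot `κ`.
    Attached : Fin n → List (Fin n) → Set
    Attached γ l = ∃₂ λ a κ → adj G γ a ≡ true × κ ∈ ks × Trail G a κ l × Unique l × All Outside l ×
      (∀ {v} → v ∈ l → v ∈ ks → v ≡ κ)

    attach : ∀ {z l} → onCycle C z ≡ true → PathTo z l →
      ∃₂ λ γ l′ → onCycle C γ ≡ true × γ ∈ l × (∀ {v} → v ∈ l′ → v ∈ l) × Attached γ l′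
    attach on p with trim ks-out p
    ... | inj₁ none with () ← trans (sym on) (All.lookup none (path-start p))
    ... | inj₂ (γ , a , l′ , onγ , γ∈ , f , q , sub , none) with path-trail q
    ... | κ , κ∈ , t′ , u , only = γ , l′ , onγ , γ∈ , sub , a , κ , f , κ∈ , t′ , u , none , only

    conclude : Pair (cyc 0) (cyc 1) → length ks + 2 ≤ 2 * k
    conclude (_ , _ , p , q , d) with attach (cyc-onCycle 0) p | attach (cyc-onCycle 1) q
    ... | γ , l , onγ , γ∈ , subl , a , κ , f , κ∈ , tl , ul , outl , onlyl
        | γ′ , m , onγ′ , γ′∈ , subm , b , κ′ , f′ , κ′∈ , tm , um , outm , onlym
      with trail-uncons (trail-reverse tm)
    ... | r , rev≡ with long-arc t e uks κ∈ κ′∈ (λ { refl → d (subl (trail-end∈ tl)) (subm (trail-end∈ tm)) })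
    ... | W , tW , uW , subW , lenW with trail-uncons tW
    ... | Z , refl = ≤-trans lenW (*-monoʳ-≤ 2 (≤-trans lenQ (half-c (ear-both onγ onγ′
          (λ { refl → d γ∈ γ′∈ }) trail unique outside f (adj-flip G f′)))))
      where
      -- Consecutive pieces share the feet `κ` and `κ′`, so the first vertex of `W` and that of the
      -- reversed `m` are dropped.
      Q : List (Fin n)
      Q = (l ++ Z) ++ r
      r⊆m : ∀ {v} → v ∈ r → v ∈ m
      r⊆m v∈ = ∈-reverse⁻ (subst (_ ∈_) (sym rev≡) (there v∈))
      κ′r-unique : Unique (κ′ ∷ r)
      κ′r-unique = subst Unique rev≡ (Unique-reverse um)
      trail : Trail G a b Q
      trail = trail-join (trail-join tl tW) (subst (Trail G κ′ b) rev≡ (trail-reverse tm))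
      l-m : Disjoint l m
      l-m v∈ v∈′ = d (subl v∈) (subm v∈′)
      head∉ : ∀ {v : Fin n} {vs} → Unique (v ∷ vs) → v ∉ vs
      head∉ (h ∷ _) v∈ = All.lookup h v∈ refl
      tail-unique : ∀ {v : Fin n} {vs} → Unique (v ∷ vs) → Unique vs
      tail-unique (_ ∷ u) = u
      unique : Unique Q
      unique = Unique.++⁺ (Unique.++⁺ ul (tail-unique uW) λ { (v∈l , v∈Z) → l-Z v∈l v∈Z }) (tail-unique κ′r-unique)
          λ { (v∈ , v∈r) → lZ-r (∈-++⁻ l v∈) v∈r }
        where
        l-Z : Disjoint l Z
        l-Z v∈l v∈Z with onlyl v∈l (subW (there v∈Z))
        ... | refl = head∉ uW v∈Z
        lZ-r : ∀ {v} → v ∈ l ⊎ v ∈ Z → v ∉ r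
        lZ-r (inj₁ v∈l) v∈r = l-m v∈l (r⊆m v∈r)
        lZ-r (inj₂ v∈Z) v∈r with onlym (r⊆m v∈r) (subW (there v∈Z))
        ... | refl = head∉ κ′r-unique v∈r
      outside : All Outside Q
      outside = All.tabulate (λ v∈ → pick (∈-++⁻ (l ++ Z) v∈))
        where
        pick : ∀ {v} → v ∈ l ++ Z ⊎ v ∈ r → Outside v
        pick (inj₂ v∈) = All.lookup outm (r⊆m v∈)
        pick (inj₁ v∈) with ∈-++⁻ l v∈
        ... | inj₁ v∈l = All.lookup outl v∈l
        ... | inj₂ v∈Z = ks-out (subW (there v∈Z))
      lenQ : suc (length Z) ≤ length Q
      lenQ = begin
        1 + length Z          ≤⟨ +-monoˡ-≤ (length Z) (trail-nonempty tl) ⟩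
        length l + length Z   ≡⟨ length-++ l ⟨
        length (l ++ Z)       ≤⟨ m≤m+n _ (length r) ⟩
        length (l ++ Z) + length r ≡⟨ length-++ (l ++ Z) ⟨
        length Q              ∎
        where open ≤-Reasoning

-- Attachments of outside paths

count-tabulate-cnt : ∀ {A : Set} (p : A → Bool) (M : ℕ → Bool) a L (f : Fin L → A) →
  (∀ i → p (f i) ≡ M (a + toℕ i)) → count p (tabulate f) ≡ cnt M a L
count-tabulate-cnt p M a zero f h = refl
count-tabulate-cnt p M a (suc L) f h
  rewrite trans (h Fin.zero) (cong M (+-identityʳ a))
        | count-tabulate-cnt p M (suc a) L (f ∘ Fin.suc) (λ i → trans (h (Fin.suc i)) (cong M (+-suc a (toℕ i))))
  with M a
... | true = refl
... | false = refl

module Attachments {n : ℕ} (G : Graph n) {c : ℕ} (C : Fin c → Fin n) (long : IsLongestCycle G c C)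
  (connected : Connected G) (connectedMinus : ∀ v → ConnectedMinus G v) {k : ℕ}
  (4≤k : 4 ≤ k) (c≤ : c ≤ 2 * k + 3) where

  open LongestCycle G C long
  open TwoConnected G C long connected connectedMinus {k} c≤

  deg : (Fin n → Bool) → Fin n → ℕ
  deg P v = # (λ w → P w ∧ adj G v w)

  degC : Fin n → ℕ
  degC = deg (onCycle C)

  Nbr : Fin n → ℕ → Bool
  Nbr v i = adj G v (cyc i)

  Nbr-periodic : ∀ v → Periodic c (Nbr v)
  Nbr-periodic v i = cong (adj G v) (cyc-periodic i)

  degC-cnt : ∀ v → degC v ≡ cnt (Nbr v) 0 c
  degC-cnt v = trans (#-onCycle C C-injective (adj G v))
    (count-tabulate-cnt (adj G v ∘ C) (Nbr v) 0 c (λ i → i) (λ i → cong (adj G v) (sym (cyc-toℕ i))))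

  -- `ear` covers positions less than a turn apart; for all others the bound on the path length is
  -- enough.
  path-gap : ∀ {x y l} → Trail G x y l → Unique l → All Outside l → suc (length l) ≤ c →
    Gap (suc (length l)) (Nbr x) (Nbr y)
  path-gap {x} {y} {l} t u out short {i} {j} i<j Xi Yj with j <? i + c
  ... | yes j< = ear i<j j< t u out (adj-flip G Xi) Yj
  ... | no j≮ = ≤-trans (+-monoʳ-≤ i short) (≮⇒≥ j≮)

  vertex-gap : ∀ {x} → Outside x → Gap 2 (Nbr x) (Nbr x)
  vertex-gap out = path-gap stop ([] ∷ []) (out ∷ []) (≤-trans (s≤s (s≤s z≤n)) 3≤c)

  -- Collects the hypotheses of `two-type-count` on the attachments of the two ends of a path with
  -- `p` vertices.
  record Separated (p : ℕ) (x y : Fin n) : Set where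
    field
      gap   : Gap 2 (λ i → Nbr x i ∨ Nbr y i) (λ i → Nbr x i ∨ Nbr y i)
      gapXY : Gap (suc p) (Nbr x) (Nbr y)
      gapYX : Gap (suc p) (Nbr y) (Nbr x)
      {i j} : ℕ
      i<j   : i < j
      j<i+c : j < i + c
      Xi    : Nbr x i ≡ true
      Yj    : Nbr y j ≡ true

  separated : ∀ {x y l γ γ′} → Trail G x y l → Unique l → All Outside l →
    onCycle C γ ≡ true → onCycle C γ′ ≡ true → γ ≢ γ′ → adj G x γ ≡ true → adj G y γ′ ≡ true →
    Separated (length l) x y
  separated {x} {y} {l} t u out on on′ γ≢γ′ e f with cyc-surjective on | cyc-surjective on′
  ... | i , i< , refl | j , j< , refl = choose (<-cmp i j)
    where
    short : suc (length l) ≤ c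
    short = ≤-trans (m≤n*m _ 2) (ear-both on on′ γ≢γ′ t u out (adj-flip G e) f)
    XY : Gap (suc (length l)) (Nbr x) (Nbr y)
    XY = path-gap t u out short
    YX : Gap (suc (length l)) (Nbr y) (Nbr x)
    YX = subst (λ z → Gap (suc z) (Nbr y) (Nbr x)) (length-reverse l)
      (path-gap (trail-reverse t) (Unique-reverse u) (All.tabulate (λ v∈ → All.lookup out (∈-reverse⁻ v∈)))
        (subst (λ z → suc z ≤ c) (sym (length-reverse l)) short))
    weaken : ∀ {X Y} → Gap (suc (length l)) X Y → Gap 2 X Y
    weaken g {a} lt p q = ≤-trans (+-monoʳ-≤ a (s≤s (trail-nonempty t))) (g lt p q)
    both : Gap 2 (λ i → Nbr x i ∨ Nbr y i) (λ i → Nbr x i ∨ Nbr y i)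
    both lt p q with ∨-true p | ∨-true q
    ... | inj₁ a | inj₁ b = vertex-gap (All.lookup out (trail-start∈ t)) lt a b
    ... | inj₁ a | inj₂ b = weaken XY lt a b
    ... | inj₂ a | inj₁ b = weaken YX lt a b
    ... | inj₂ a | inj₂ b = vertex-gap (All.lookup out (trail-end∈ t)) lt a b
    choose : _ → Separated (length l) x y
    choose (tri< i<j _ _) = record { gap = both ; gapXY = XY ; gapYX = YX ; i<j = i<j ; j<i+c = ≤-trans j<
        (m≤n+m c i) ; Xi = e ; Yj = f }
    choose (tri≈ _ refl _) = ⊥-elim (γ≢γ′ refl)
    -- The attachment of `y` is moved one turn forward, so that it comes after that of `x`.
    choose (tri> _ _ j<i) = record { gap = both ; gapXY = XY ; gapYX = YX ; i<j = ≤-trans i<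
        (m≤n+m c j) ; j<i+c = +-monoˡ-< c j<i ; Xi = e ; Yj = trans (Nbr-periodic y j) f }

  -- Either `x` has a neighbour on the cycle other than `γ`, and the ends have distinct attachments,
  -- or `γ` is the only candidate.
  degC≤1-or-separated : ∀ {x y l γ} → Trail G x y l → Unique l → All Outside l →
    onCycle C γ ≡ true → adj G y γ ≡ true → degC x ≤ 1 ⊎ Separated (length l) x y
  degC≤1-or-separated {x} {y} {l} {γ} t u out on f
    with Fin.any? (λ v → (onCycle C v Bool.≟ true) ×-dec (adj G x v Bool.≟ true) ×-dec ¬? (v Fin.≟ γ))
  ... | yes (v , on′ , e , v≢γ) = inj₂ (separated t u out on′ on v≢γ e f)
  ... | no none = inj₁ (#≤length only)
    where
    only : ∀ v → onCycle C v ∧ adj G x v ≡ true → v ∈ [ γ ]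
    only v h with v Fin.≟ γ
    ... | yes e = here e
    ... | no v≢γ = ⊥-elim (none (v , ∧-trueˡ h , ∧-trueʳ {onCycle C v} h , v≢γ))

  -- The walk is followed until its next vertex lies on the cycle; a repeated vertex is removed by
  -- cutting out the detour.
  exit-path : ∀ {u w z} → Walk G (_≢ u) w z → onCycle C z ≡ true → Outside w →
    ∃₂ λ v l → ∃ λ γ → Trail G w v l × Unique l × All Outside l × u ∉ l × onCycle C γ ≡ true × adj G v γ ≡ true
  exit-path (nil _) on out with () ← trans (sym on) out
  exit-path {w = w} (cons {y = y} w≢u e walk) on out with onCycle C y in on-y
  ... | true = w , [ w ] , y , stop , ([] ∷ []) , (out ∷ []) , (λ { (here refl) → w≢u refl }) , on-y , e
  ... | false with exit-path walk on on-y
  ... | v , l , γ , t , u , o , u∉ , onγ , f with w ∈? l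
  ... | no w∉ = v , w ∷ l , γ , e ◂ t , (All.tabulate (λ { p refl → w∉ p }) ∷ u) , (out ∷ o) ,
        (λ { (here refl) → w≢u refl ; (there p) → u∉ p }) , onγ , f
  ... | yes w∈ with ∈-∃++ w∈
  ... | as , bs , refl = v , w ∷ bs , γ , proj₂ (trail-split as t) , proj₁ (proj₂ (Unique-++⁻ as u)) ,
        All.tabulate (λ p → All.lookup o (∈-++⁺ʳ as p)) , (λ p → u∉ (∈-++⁺ʳ as p)) , onγ , f

  -- An outside vertex has no two consecutive neighbours on a longest cycle, so it has at most half
  -- of `c`.
  degC≤suc-k : ∀ {u} → Outside u → degC u ≤ suc k
  degC≤suc-k {u} out rewrite degC-cnt u = half-≤ (≤-trans (2-gap-count (Nbr-periodic u) (vertex-gap out))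
      (≤-trans c≤ (≤-reflexive (eq k))))
    where
    eq : ∀ k → 2 * k + 3 ≡ 2 * suc k + 1
    eq = solve-∀

  -- The path from `u` over `w` to the cycle has at least two vertices, so `two-type-count` yields 4
  -- + 2 `degC u` ≤ c + 2 ≤ 2k + 5, unless `u` has at most one neighbour on the cycle.
  non-isolated-degC : ∀ {u w} → Outside u → Outside w → adj G u w ≡ true → degC u ≤ k
  non-isolated-degC {u} {w} out out-w e
    with exit-path (connectedMinus u w (cyc 0) (adj-≢ G e ∘ sym) (on-off (cyc-onCycle 0) out)) (cyc-onCycle 0) out-w
  ... | v , l , γ , t , ul , o , u∉ , onγ , f
    with degC≤1-or-separated (e ◂ t) (All.tabulate (λ { p refl → u∉ p }) ∷ ul) (out ∷ o) onγ f
  ... | inj₁ ≤1 = ≤-trans ≤1 (≤-trans (s≤s z≤n) 4≤k)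
  ... | inj₂ sep = subst (_≤ k) (sym (degC-cnt u)) (half-≤ (≤-by-cancel _ _ 4 (begin
      2 * X + 4           ≡⟨ +-comm (2 * X) 4 ⟩
      4 + 2 * X           ≤⟨ +-mono-≤ (*-monoʳ-≤ 2 (s≤s (trail-nonempty t))) (*-monoʳ-≤ 2 (cnt-mono
          (λ _ → ∨-trueˡ) 0 c)) ⟩
      2 * suc (length l) + 2 * cnt (λ i → Nbr u i ∨ Nbr v i) 0 c
                          ≤⟨ proj₁ (two-type-count (Nbr-periodic u)
                              (Nbr-periodic v) gap gapXY gapYX i<j j<i+c Xi Yj) ⟩
      c + 2               ≤⟨ +-monoˡ-≤ 2 c≤ ⟩
      2 * k + 3 + 2       ∎) refl (eq k)))
    where
    open ≤-Reasoning
    open Separated sep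
    X = cnt (Nbr u) 0 c
    eq : ∀ k → 2 * k + 3 + 2 ≡ 2 * k + 1 + 4
    eq = solve-∀

-- Extremal choice

climb : {A : Set} (μ : A → ℕ) (b : ℕ) → (∀ a → μ a ≤ b) → {Good : A → Set} →
  (∀ a → Good a ⊎ ∃ λ a′ → μ a < μ a′) → A → ∃ Good
climb {A} μ b bound {Good} improve a = go (suc b) a (m≤m+n (suc b) (μ a))
  where
  -- An improvement costs one unit of fuel but raises `μ`, so the sum stays above `b`; when the fuel
  -- is used up, this contradicts the bound on `μ`.
  go : ∀ fuel a → b < fuel + μ a → ∃ Good
  go zero a h = ⊥-elim (<⇒≱ h (bound a))
  go (suc fuel) a h with improve a
  ... | inj₁ good = a , good
  ... | inj₂ (a′ , lt) = go fuel a′ (≤-trans h (≤-trans (≤-reflexive (sym (+-suc fuel (μ a)))) (+-monoʳ-≤ fuel lt)))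

search : {A : Set} {P Q : A → Set} → (∀ v → P v ⊎ Q v) → (l : List A) →
  (∃ λ v → v ∈ l × P v) ⊎ (∀ {v} → v ∈ l → Q v)
search h [] = inj₂ λ ()
search h (v ∷ l) with h v
... | inj₁ p = inj₁ (v , here refl , p)
... | inj₂ q with search h l
... | inj₁ (w , w∈ , p) = inj₁ (w , there w∈ , p)
... | inj₂ qs = inj₂ λ { (here refl) → q ; (there v∈) → qs v∈ }

-- As `d` is at most `b`, the number d + (b + 1) q orders pairs lexicographically, with `q` first.
lex-< : ∀ {d b q q′} d′ → d ≤ b → q < q′ → d + suc b * q < d′ + suc b * q′
lex-< {d} {b} {q} {q′} d′ d≤b q<q′ = begin-strict
  d + suc b * q       <⟨ +-monoˡ-< (suc b * q) (s≤s d≤b) ⟩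
  suc b + suc b * q   ≡⟨ *-suc (suc b) q ⟨
  suc b * suc q       ≤⟨ *-monoʳ-≤ (suc b) q<q′ ⟩
  suc b * q′          ≤⟨ m≤n+m _ d′ ⟩
  d′ + suc b * q′     ∎
  where open ≤-Reasoning

∈-take : {A : Set} {w : A} (as : List A) {bs : List A} {m : ℕ} → suc (length as) ≤ m → w ∈ take m (as ++ w ∷ bs)
∈-take [] {m = suc m} _ = here refl
∈-take (a ∷ as) {m = suc m} (s≤s h) = there (∈-take as h)

-- Rotations

module Predecessors {n : ℕ} (G : Graph n) where

  predsFrom : Fin n → Fin n → List (Fin n) → List (Fin n)
  predsFrom x a [] = []
  predsFrom x a (b ∷ l) with adj G x b
  ... | true = a ∷ predsFrom x b l
  ... | false = predsFrom x b l

  -- For a path from x, these are the ends that replace x after a Pósa rotation.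
  preds : Fin n → List (Fin n) → List (Fin n)
  preds x [] = []
  preds x (a ∷ l) = predsFrom x a l

  predsFrom-⊆ : ∀ x a l {v} → v ∈ predsFrom x a l → v ∈ a ∷ l
  predsFrom-⊆ x a (b ∷ l) v∈ with adj G x b
  predsFrom-⊆ x a (b ∷ l) (here e) | true = here e
  predsFrom-⊆ x a (b ∷ l) (there v∈) | true = there (predsFrom-⊆ x b l v∈)
  predsFrom-⊆ x a (b ∷ l) v∈ | false = there (predsFrom-⊆ x b l v∈)

  preds-⊆ : ∀ x l {v} → v ∈ preds x l → v ∈ l
  preds-⊆ x (a ∷ l) = predsFrom-⊆ x a l

  predsFrom-unique : ∀ x a {l} → Unique (a ∷ l) → Unique (predsFrom x a l)
  predsFrom-unique x a {[]} u = []
  predsFrom-unique x a {b ∷ l} (h ∷ u) with adj G x b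
  ... | true = All.tabulate (λ v∈ → All.lookup h (predsFrom-⊆ x b l v∈)) ∷ predsFrom-unique x b u
  ... | false = predsFrom-unique x b u

  preds-unique : ∀ x {l} → Unique l → Unique (preds x l)
  preds-unique x {[]} u = []
  preds-unique x {a ∷ l} u = predsFrom-unique x a u

  predsFrom-split : ∀ x a l {s} → s ∈ predsFrom x a l →
    ∃₂ λ as t → ∃ λ bs → a ∷ l ≡ as ++ s ∷ t ∷ bs × adj G x t ≡ true
  predsFrom-split x a (b ∷ l) s∈ with adj G x b in e
  predsFrom-split x a (b ∷ l) (here refl) | true = [] , b , l , refl , e
  predsFrom-split x a (b ∷ l) (there s∈) | true with predsFrom-split x b l s∈
  ... | as , t , bs , eq , f = a ∷ as , t , bs , cong (a ∷_) eq , f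
  predsFrom-split x a (b ∷ l) s∈ | false with predsFrom-split x b l s∈
  ... | as , t , bs , eq , f = a ∷ as , t , bs , cong (a ∷_) eq , f

  preds-split : ∀ x l {s} → s ∈ preds x l → ∃₂ λ as t → ∃ λ bs → l ≡ as ++ s ∷ t ∷ bs × adj G x t ≡ true
  preds-split x (a ∷ l) = predsFrom-split x a l

  length-predsFrom : ∀ x a l → length (predsFrom x a l) ≡ length (filter (true? (adj G x)) l)
  length-predsFrom x a [] = refl
  length-predsFrom x a (b ∷ l) with adj G x b
  ... | true = cong suc (length-predsFrom x b l)
  ... | false = length-predsFrom x b l

-- Removable sets of outside vertices

module Removal {n : ℕ} (G : Graph n) {c : ℕ} (C : Fin c → Fin n) (long : IsLongestCycle G c C)
  (connected : Connected G) (connectedMinus : ∀ v → ConnectedMinus G v) {k : ℕ}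
  (4≤k : 4 ≤ k) (c≤ : c ≤ 2 * k + 3) where

  open LongestCycle G C long
  open TwoConnected G C long connected connectedMinus {k} c≤
  open Attachments G C long connected connectedMinus 4≤k c≤
  open Predecessors G

  nbrs : (Fin n → Bool) → Fin n → List (Fin n)
  nbrs P v = filter (true? (λ w → P w ∧ adj G v w)) (allFin n)

  length-nbrs : ∀ P v → length (nbrs P v) ≡ deg P v
  length-nbrs P v = sym (count-filter (λ w → P w ∧ adj G v w) (allFin n))

  nbrs-unique : ∀ P v → Unique (nbrs P v)
  nbrs-unique P v = Unique.filter⁺ (true? (λ w → P w ∧ adj G v w)) (Unique.allFin⁺ n)

  ∈-nbrs⁻ : ∀ {P v w} → w ∈ nbrs P v → P w ≡ true × adj G v w ≡ true
  ∈-nbrs⁻ {P} {v} {w} w∈ with proj₂ (∈-filter⁻ (true? (λ w → P w ∧ adj G v w)) {xs = allFin n} w∈)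
  ... | e = ∧-trueˡ e , ∧-trueʳ {P w} e

  _∖_ : (Fin n → Bool) → List (Fin n) → Fin n → Bool
  (P ∖ S) v = P v ∧ not (does (v ∈? S))

  ∖-⊆ : ∀ P S {v} → (P ∖ S) v ≡ true → P v ≡ true
  ∖-⊆ P S = ∧-trueˡ

  ∖-∉ : ∀ P S {v} → (P ∖ S) v ≡ true → v ∉ S
  ∖-∉ P S {v} e v∈ with P v | v ∈? S
  ... | true | no v∉ = v∉ v∈

  module _ (H : Fin n → Bool) (H-out : ∀ {v} → H v ≡ true → Outside v) where

    NbrsIn : List (Fin n) → Fin n → Set
    NbrsIn R v = ∀ {w} → H w ≡ true → adj G v w ≡ true → w ∈ R

    Escape : List (Fin n) → Fin n → Set
    Escape l v = ∃ λ w → H w ≡ true × adj G v w ≡ true × w ∉ l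

    escape? : ∀ l v → Escape l v ⊎ NbrsIn l v
    escape? l v with Fin.any? (λ w → (H w Bool.≟ true) ×-dec (adj G v w Bool.≟ true) ×-dec ¬? (w ∈? l))
    ... | yes esc = inj₁ esc
    ... | no none = inj₂ λ {w} h e → decidable-stable (w ∈? l) (λ w∉ → none (w , h , e , w∉))

    -- The inequality is strict because `l` contains `v` besides its neighbours.
    deg<length : ∀ {l v} → v ∈ l → NbrsIn l v → suc (deg H v) ≤ length l
    deg<length {l} {v} v∈ nb = subst (λ z → suc z ≤ length l) (length-nbrs H v)
      (length-⊆ (All.tabulate (λ w∈ → adj-≢ G (proj₂ (∈-nbrs⁻ {H} w∈))) ∷ nbrs-unique H v)
        λ { (here refl) → v∈ ; (there w∈) → nb (proj₁ (∈-nbrs⁻ {H} w∈)) (proj₂ (∈-nbrs⁻ {H} w∈)) })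

    record Path : Set where
      constructor path
      field
        {x y} : Fin n
        {l} : List (Fin n)
        trail : Trail G x y l
        unique : Unique l
        inside : All (λ v → H v ≡ true) l

      S : List (Fin n)
      S = preds x l
      outside : All Outside l
      outside = All.map H-out inside

    open Path

    longest-bound : ∀ P → length (l P) ≤ n
    longest-bound P = subst (length (l P) ≤_) (length-tabulate (λ i → i)) (length-⊆ (unique P) (λ _ → ∈-allFin _))

    reverse-path : Path → Path
    reverse-path (path t u h) = path (trail-reverse t) (Unique-reverse u) (All.tabulate (λ v∈ → All.lookup h
        (∈-reverse⁻ v∈)))

    extend-path : (P : Path) → Escape (l P) (x P) → Path
    extend-path (path t u h) (w , Hw , e , w∉) = path (adj-flip G e ◂ t) (All.tabulate
        (λ { p refl → w∉ p }) ∷ u) (Hw ∷ h)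

    module _ (P : Path) {s : Fin n} (as : List (Fin n)) {t : Fin n} {bs : List (Fin n)}
      (eq : l P ≡ as ++ s ∷ t ∷ bs) (e : adj G (x P) t ≡ true) where

      -- The edge from `s` to `t` is exchanged for the edge from `x P` to `t`: the path runs from
      -- `s` back to `x P`, then from `t` on to `y P`.
      rotated : List (Fin n)
      rotated = reverse (as ++ [ s ]) ++ t ∷ bs

      rotated-↭ : rotated ↭ l P
      rotated-↭ = begin
        reverse (as ++ [ s ]) ++ t ∷ bs ↭⟨ ++⁺ʳ (t ∷ bs) (↭-reverse (as ++ [ s ])) ⟩
        (as ++ [ s ]) ++ t ∷ bs         ≡⟨ ++-assoc as [ s ] (t ∷ bs) ⟩
        as ++ s ∷ t ∷ bs                ≡⟨ eq ⟨
        l P                             ∎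
        where open PermutationReasoning

      rotated-trail : Trail G s (y P) rotated
      rotated-trail with trail-split₂ as (subst (Trail G (x P) (y P)) eq (trail P))
      ... | t₁ , _ , t₂ = trail-++ (trail-reverse t₁) e t₂

      rotate-path : Path
      rotate-path = path rotated-trail (Unique-resp-↭ (↭-sym rotated-↭) (unique P))
        (All.tabulate (λ v∈ → All.lookup (inside P) (∈-resp-↭ rotated-↭ v∈)))

    rotate : (P : Path) {s : Fin n} → s ∈ S P → ∃ λ P′ → x P′ ≡ s × y P′ ≡ y P × l P′ ↭ l P
    rotate P s∈ with preds-split (x P) (l P) s∈
    ... | as , t , bs , eq , e = rotate-path P as eq e , refl , refl , rotated-↭ P as eq e

    -- Capped at 1, so that one more vertex, with weight 2 in `measure`, always outweighs it.
    flag : Path → ℕ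
    flag P = 1 ⊓ degC (y P)

    -- Lexicographic in the length, the attachment of the end y to C, and the degree of the end x.
    measure : Path → ℕ
    measure P = deg H (x P) + suc n * (flag P + 2 * length (l P))

    deg≤n : ∀ P v → deg P v ≤ n
    deg≤n P v = subst (deg P v ≤_) (length-tabulate {n = n} (λ i → i))
        (#≤length {p = λ w → P w ∧ adj G v w} {l = allFin n} (λ i _ → ∈-allFin i))

    measure-bound : ∀ P → measure P ≤ n + suc n * (1 + 2 * n)
    measure-bound P = +-mono-≤ (deg≤n H (x P)) (*-monoʳ-≤ (suc n) (+-mono-≤ (m⊓n≤m 1 (degC (y P)))
        (*-monoʳ-≤ 2 (longest-bound P))))

    longer-better : ∀ P P′ → length (l P) < length (l P′) → measure P < measure P′
    longer-better P P′ lt = lex-< (deg H (x P′)) (deg≤n H (x P)) (begin-strict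
      flag P + 2 * length (l P)     ≤⟨ +-monoˡ-≤ _ (m⊓n≤m 1 (degC (y P))) ⟩
      1 + 2 * length (l P)          <⟨ n<1+n _ ⟩
      2 + 2 * length (l P)          ≡⟨ *-suc 2 _ ⟨
      2 * suc (length (l P))        ≤⟨ *-monoʳ-≤ 2 lt ⟩
      2 * length (l P′)             ≤⟨ m≤n+m _ (flag P′) ⟩
      flag P′ + 2 * length (l P′)   ∎)
      where open ≤-Reasoning

    -- All that is used of the maximality of a path: each failing field would allow a path of larger
    -- measure.
    record Good (P : Path) : Set where
      field
        nbrs-x : NbrsIn (l P) (x P)
        nbrs-y : NbrsIn (l P) (y P)
        nbrs-S : ∀ {s} → s ∈ S P → NbrsIn (l P) s
        deg-S  : ∀ {s} → s ∈ S P → deg H s ≤ deg H (x P)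
        attached : (1 ≤ degC (y P)) ⊎ (∀ {s} → s ∈ S P → degC s ≤ 0)

    Better : Path → Set
    Better P = ∃ λ P′ → measure P < measure P′

    extend-better : ∀ P P′ → l P′ ↭ l P → Escape (l P′) (x P′) → Better P
    extend-better P P′ perm esc = extend-path P′ esc , longer-better P (extend-path P′ esc) (s≤s
        (≤-reflexive (sym (↭-length perm))))

    escape-better : ∀ P {s} → s ∈ S P → Escape (l P) s → Better P
    escape-better P s∈ (w , h , e , w∉) with rotate P s∈
    ... | P′ , refl , _ , perm = extend-better P P′ perm (w , h , e , λ w∈ → w∉ (∈-resp-↭ perm w∈))

    degree-better : ∀ P {s} → s ∈ S P → deg H (x P) < deg H s → Better P
    degree-better P s∈ lt with rotate P s∈
    ... | P′ , refl , refl , perm = P′ , <-≤-trans (+-monoˡ-< _ lt)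
      (≤-reflexive (cong (λ z → deg H (x P′) + suc n * (flag P′ + 2 * z)) (sym (↭-length perm))))

    -- Rotating to `s` and then reversing makes `s` the fixed end, now attached to the cycle, at
    -- unchanged length.
    attached-better : ∀ P {s} → s ∈ S P → degC (y P) ≤ 0 → 1 ≤ degC s → Better P
    attached-better P s∈ none some with rotate P s∈
    ... | P′ , refl , _ , perm = reverse-path P′ , lex-< (deg H (y P′)) (deg≤n H (x P)) (begin-strict
        1 ⊓ degC (y P) + 2 * length (l P)           ≤⟨ +-monoˡ-≤ _ (≤-trans (m⊓n≤n 1 (degC (y P))) none) ⟩
        2 * length (l P)                            <⟨ n<1+n _ ⟩
        1 + 2 * length (l P)
            ≡⟨ cong₂ (λ a b → a + 2 * b) (m≤n⇒m⊓n≡m some) (trans (length-reverse (l P′)) (↭-length perm)) ⟨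
        1 ⊓ degC (x P′) + 2 * length (reverse (l P′)) ∎)
      where open ≤-Reasoning

    improve : ∀ P → Good P ⊎ Better P
    improve P with escape? (l P) (x P)
    ... | inj₁ esc = inj₂ (extend-better P P ↭-refl esc)
    ... | inj₂ nx with escape? (l P) (y P)
    ... | inj₁ (w , h , e , w∉) = inj₂ (extend-better P (reverse-path P) (↭-reverse (l P))
        (w , h , e , λ w∈ → w∉ (∈-reverse⁻ w∈)))
    ... | inj₂ ny with search (escape? (l P)) (S P)
    ... | inj₁ (s , s∈ , esc) = inj₂ (escape-better P s∈ esc)
    ... | inj₂ ns with search (λ s → <-≤-connex (deg H (x P)) (deg H s)) (S P)
    ... | inj₁ (s , s∈ , lt) = inj₂ (degree-better P s∈ lt)
    ... | inj₂ ds with <-≤-connex 0 (degC (y P))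
    ... | inj₁ some = inj₁ (record { nbrs-x = nx ; nbrs-y = ny ; nbrs-S = ns ; deg-S = ds ; attached = inj₁ some })
    ... | inj₂ none with search (λ s → <-≤-connex 0 (degC s)) (S P)
    ... | inj₁ (s , s∈ , some) = inj₂ (attached-better P s∈ none some)
    ... | inj₂ zeros = inj₁ (record { nbrs-x = nx ; nbrs-y = ny ; nbrs-S = ns ; deg-S = ds ; attached = inj₂ zeros })

    good-path : Path → ∃ Good
    good-path = climb measure _ measure-bound improve

    -- The edge from `w` to the start closes the path up to `w`, and `outside-cycle-bound` applies.
    outside-prefix-bound : ∀ {z z′ w} ps {qs} → Trail G z z′ (ps ++ w ∷ qs) → Unique (ps ++ w ∷ qs) →
      All Outside (ps ++ w ∷ qs) → adj G w z ≡ true → suc (length ps) ≤ 2 * k ∸ 2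
    outside-prefix-bound ps {qs} t u out e = m+n≤o⇒m≤o∸n _ (begin
      suc (length ps) + 2          ≡⟨ cong (_+ 2) (trans (length-++ ps) (+-comm (length ps) 1)) ⟨
      length (ps ++ [ _ ]) + 2     ≤⟨ outside-cycle-bound (proj₁ (trail-split ps t)) e (proj₁ (Unique-++⁻
          (ps ++ [ _ ]) (subst Unique regroup u)))
                                       (All.tabulate (λ v∈ → All.lookup out (subst (_ ∈_) (sym regroup)
                                           (∈-++⁺ˡ v∈)))) ⟩
      2 * k                        ∎)
      where
      open ≤-Reasoning
      regroup : ps ++ _ ∷ qs ≡ (ps ++ [ _ ]) ++ qs
      regroup = sym (++-assoc ps [ _ ] qs)

    -- All neighbours of `x` in `H` lie on the path behind `x`, and each contributes its predecessor
    -- to `S`.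
    deg-x≤|S| : ∀ P → Good P → deg H (x P) ≤ length (S P)
    deg-x≤|S| (path {x} t u h) good with trail-uncons t
    ... | m , refl = subst (deg H x ≤_) (sym (length-predsFrom x x m)) (#≤length in-tail)
      where
      in-tail : ∀ w → H w ∧ adj G x w ≡ true → w ∈ filter (true? (adj G x)) m
      in-tail w e with Good.nbrs-x good (∧-trueˡ e) (∧-trueʳ {H w} e)
      ... | here refl = ⊥-elim (adj-≢ G (∧-trueʳ {H w} e) refl)
      ... | there w∈ = ∈-filter⁺ (true? (adj G x)) w∈ (∧-trueʳ {H w} e)

    module _ (P : Path) (good : Good P) {s : Fin n} (s∈ : s ∈ S P) where
      open Good good

      -- The edge from `x P` to `t` bounds the position of `t`, hence the part before it. A
      -- neighbour of `s` from `t` on keeps its position when the path is rotated to start at `s`,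
      -- so its edge to `s` closes a prefix of the rotated path and its position is bounded too.
      S-nbrs-in-prefix : NbrsIn (take (2 * k ∸ 2) (l P)) s × s ∈ take (2 * k ∸ 2) (l P)
      S-nbrs-in-prefix with preds-split (x P) (l P) s∈
      ... | as , t , bs , eq , e = nb , s∈take
        where
        m = 2 * k ∸ 2
        eq′ : l P ≡ (as ++ [ s ]) ++ t ∷ bs
        eq′ = trans eq (sym (++-assoc as [ s ] (t ∷ bs)))
        into : ∀ {w} ps {qs} → l P ≡ ps ++ w ∷ qs → suc (length ps) ≤ m → w ∈ take m (l P)
        into ps eq le = subst (λ z → _ ∈ take m z) (sym eq) (∈-take ps le)
        front : suc (length (as ++ [ s ])) ≤ m
        front = outside-prefix-bound (as ++ [ s ]) (subst (Trail G (x P) (y P)) eq′ (trail P))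
            (subst Unique eq′ (unique P))
                  (subst (All Outside) eq′ (outside P)) (adj-flip G e)
        in-front : ∀ {w} → w ∈ as ++ [ s ] → w ∈ take m (l P)
        in-front w∈ with ∈-∃++ w∈
        ... | ps , qs , eq″ = into ps (trans eq′ (trans (cong (_++ t ∷ bs) eq″) (++-assoc ps _ (t ∷ bs))))
          (≤-trans (≤-trans (≤-trans (m≤m+n _ (length qs)) (≤-reflexive (trans (sym (+-suc (length ps)
              (length qs))) (trans (sym (length-++ ps)) (cong length (sym eq″)))))) (n≤1+n _)) front)
        s∈take : s ∈ take m (l P)
        s∈take = in-front (∈-++⁺ʳ as (here refl))
        nb : NbrsIn (take m (l P)) s
        nb {w} h f with ∈-++⁻ (as ++ [ s ]) (subst (w ∈_) eq′ (nbrs-S s∈ h f))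
        ... | inj₁ w∈ = in-front w∈
        ... | inj₂ w∈ with ∈-∃++ w∈
        ... | ps , qs , eq″ = into ((as ++ [ s ]) ++ ps) (trans eq′ (trans (cong ((as ++ [ s ]) ++_) eq″)
            (sym (++-assoc (as ++ [ s ]) ps _))))
            (subst (λ z → suc z ≤ m) len (outside-prefix-bound (reverse (as ++ [ s ]) ++ ps)
              (subst (Trail G s (y P)) rot≡ (rotated-trail P as eq e)) (subst Unique rot≡ (unique Q)) (subst
                  (All Outside) rot≡ (outside Q)) (adj-flip G f)))
          where
          Q : Path
          Q = rotate-path P as eq e
          rot≡ : l Q ≡ (reverse (as ++ [ s ]) ++ ps) ++ w ∷ qs
          rot≡ = trans (cong (reverse (as ++ [ s ]) ++_) eq″) (sym (++-assoc (reverse (as ++ [ s ])) ps _))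
          len : length (reverse (as ++ [ s ]) ++ ps) ≡ length ((as ++ [ s ]) ++ ps)
          len = trans (length-++ (reverse (as ++ [ s ]))) (trans (cong (_+ length ps) (length-reverse
              (as ++ [ s ]))) (sym (length-++ (as ++ [ s ]))))

      -- The set `S P` and the neighbours of `s` outside it are disjoint subsets of `R`, and `S P`
      -- has at least `deg H s` elements.
      S-degree-sum : ∀ {R} → (∀ {v} → v ∈ S P → v ∈ R) → NbrsIn R s → deg H s + deg (H ∖ S P) s ≤ length R
      S-degree-sum {R} S⊆R nb = begin
        deg H s + deg (H ∖ S P) s                        ≤⟨ +-monoˡ-≤ _ (≤-trans (deg-S s∈) (deg-x≤|S| P good)) ⟩
        length (S P) + deg (H ∖ S P) s                   ≡⟨ cong (length (S P) +_) (length-nbrs (H ∖ S P) s) ⟨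
        length (S P) + length (nbrs (H ∖ S P) s)         ≡⟨ length-++ (S P) ⟨
        length (S P ++ nbrs (H ∖ S P) s)
            ≤⟨ length-⊆ (Unique.++⁺ (preds-unique (x P) (unique P)) (nbrs-unique (H ∖ S P) s)
                                                              λ { (v∈ , v∈′) → ∖-∉ H (S P) (proj₁
                                                                  (∈-nbrs⁻ {H ∖ S P} v∈′)) v∈ }) sub ⟩
        length R                                         ∎
        where
        open ≤-Reasoning
        sub : ∀ {v} → v ∈ S P ++ nbrs (H ∖ S P) s → v ∈ R
        sub v∈ with ∈-++⁻ (S P) v∈
        ... | inj₁ v∈S = S⊆R v∈S
        ... | inj₂ v∈N with ∈-nbrs⁻ {H ∖ S P} v∈N
        ... | h , e = nb (∖-⊆ H (S P) h) e

    -- With every edge counted twice, the left sides add up to what deleting `R` takes away. An edge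
    -- inside `R` appears in the first degree at both ends; an edge leaving `R` appears in the first
    -- two degrees at its end in `R`.
    Removable : List (Fin n) → Set
    Removable R = Unique R × (∃ λ s → s ∈ R) × (∀ {s} → s ∈ R → H s ≡ true) ×
      (∀ {s} → s ∈ R → deg H s + deg (H ∖ R) s + 2 * degC s ≤ 2 * k)

    low-degree-removable : ∀ {v} → H v ≡ true → deg H v + degC v ≤ k → Removable [ v ]
    low-degree-removable {v} h low = ([] ∷ []) , (v , here refl) , (λ { (here refl) → h }) , λ { (here refl) → begin
        deg H v + deg (H ∖ [ v ]) v + 2 * degC v  ≤⟨ +-monoˡ-≤ (2 * degC v) (+-monoʳ-≤ (deg H v) fewer) ⟩
        deg H v + deg H v + 2 * degC v            ≡⟨ eq (deg H v) (degC v) ⟩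
        2 * (deg H v + degC v)                    ≤⟨ *-monoʳ-≤ 2 low ⟩
        2 * k                                     ∎ }
      where
      open ≤-Reasoning
      eq : ∀ a b → a + a + 2 * b ≡ 2 * (a + b)
      eq = solve-∀
      fewer : deg (H ∖ [ v ]) v ≤ deg H v
      fewer = count-mono (λ w e → cong₂ _∧_ (∖-⊆ H [ v ] (∧-trueˡ e)) (∧-trueʳ {(H ∖ [ v ]) w} e)) (allFin n)

    module _ (degC≤k : ∀ {v} → H v ≡ true → degC v ≤ k) (high : ∀ {v} → H v ≡ true → suc k ≤ deg H v + degC v)
      (P : Path) (good : Good P) where
      open Good good

      H-x : H (x P) ≡ true
      H-x = All.lookup (inside P) (trail-start∈ (trail P))

      H-S : ∀ {s} → s ∈ S P → H s ≡ true
      H-S s∈ = All.lookup (inside P) (preds-⊆ (x P) (l P) s∈)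

      deg-positive : ∀ {v} → H v ≡ true → 1 ≤ deg H v
      deg-positive {v} h = +-cancelʳ-≤ (degC v) 1 _ (≤-trans (s≤s (degC≤k h)) (high h))

      H-y : H (y P) ≡ true
      H-y = All.lookup (inside P) (trail-end∈ (trail P))

      2≤length : 2 ≤ length (l P)
      2≤length = ≤-trans (s≤s (deg-positive H-y)) (deg<length (trail-end∈ (trail P)) nbrs-y)

      -- Supplies the lower bounds that `two-type-bound` asks for, with the path length as `p`.
      length+degC : ∀ {v} → H v ≡ true → v ∈ l P → NbrsIn (l P) v → k + 2 ≤ length (l P) + degC v
      length+degC {v} h v∈ nb = begin
        k + 2                       ≡⟨ +-comm k 2 ⟩
        suc (suc k)                 ≤⟨ s≤s (high h) ⟩
        suc (deg H v + degC v)      ≤⟨ +-monoˡ-≤ (degC v) (deg<length v∈ nb) ⟩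
        length (l P) + degC v       ∎
        where open ≤-Reasoning

      -- If `y P` has a neighbour on the cycle, the rotated path from `s` to `y P` lets the
      -- attachments of both ends be compared; otherwise no such `s` has any.
      few-attachments : ∀ {s} → s ∈ S P → degC s ≤ 1 ⊎ (degC s ≤ 2 × length (l P) ≤ k)
      few-attachments {s} s∈ with attached
      ... | inj₂ zeros = inj₁ (≤-trans (zeros s∈) z≤n)
      ... | inj₁ some with #-pos some
      ... | γ , γ-nbr with rotate P s∈
      ... | P′ , refl , refl , perm
        with degC≤1-or-separated (trail P′) (unique P′) (outside P′) (∧-trueˡ γ-nbr) (∧-trueʳ {onCycle C γ} γ-nbr)
      ... | inj₁ ≤1 = inj₁ ≤1
      ... | inj₂ sep = inj₂ (subst₂ (λ d p → d ≤ 2 × p ≤ k) (sym (degC-cnt (x P′))) len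
          (two-type-bound (Nbr-periodic (x P′)) (Nbr-periodic (y P′)) gap gapXY gapYX i<j j<i+c Xi Yj 4≤k
            (subst (2 ≤_) (sym len) 2≤length) c≤
            (subst₂ (λ p d → k + 2 ≤ p + d) (sym len) (degC-cnt (x P′)) (length+degC (H-S s∈) (preds-⊆ (x P)
                (l P) s∈) (nbrs-S s∈)))
            (subst₂ (λ p d → k + 2 ≤ p + d) (sym len) (degC-cnt (y P′)) (length+degC H-y (trail-end∈
                (trail P)) nbrs-y))))
        where
        open Separated sep
        len : length (l P′) ≡ length (l P)
        len = ↭-length perm

      S-nonempty : ∃ λ s → s ∈ S P
      S-nonempty with S P | ≤-trans (deg-positive H-x) (deg-x≤|S| P good)
      ... | s ∷ _ | _ = s , here refl

      rotation-removable : Removable (S P)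
      rotation-removable = preds-unique (x P) (unique P) , S-nonempty , H-S , bound
        where
        open ≤-Reasoning
        bound : ∀ {s} → s ∈ S P → deg H s + deg (H ∖ S P) s + 2 * degC s ≤ 2 * k
        bound {s} s∈ with length (l P) ≤? k
        -- Here `R` is the whole path, with at most k vertices, and 2 `degC s` ≤ 4 ≤ k.
        ... | yes short = begin
          deg H s + deg (H ∖ S P) s + 2 * degC s
              ≤⟨ +-mono-≤ (S-degree-sum P good s∈ (preds-⊆ (x P) (l P)) (nbrs-S s∈)) (*-monoʳ-≤ 2 ≤2) ⟩
          length (l P) + 4                          ≤⟨ +-mono-≤ short 4≤k ⟩
          k + k                                     ≡⟨ cong (k +_) (+-identityʳ k) ⟨
          2 * k                                     ∎
          where
          ≤2 : degC s ≤ 2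
          ≤2 with few-attachments s∈
          ... | inj₁ ≤1 = m≤n⇒m≤1+n ≤1
          ... | inj₂ (≤2 , _) = ≤2
        -- Here `R` is the prefix of at most 2k - 2 vertices, and 2 `degC s` ≤ 2.
        ... | no long-path = begin
          deg H s + deg (H ∖ S P) s + 2 * degC s    ≤⟨ +-mono-≤ (S-degree-sum P good s∈ (λ v∈ → proj₂
              (S-nbrs-in-prefix P good v∈)) (proj₁ (S-nbrs-in-prefix P good s∈))) (*-monoʳ-≤ 2 ≤1) ⟩
          length (take (2 * k ∸ 2) (l P)) + 2       ≡⟨ cong (_+ 2) (length-take (2 * k ∸ 2) (l P)) ⟩
          (2 * k ∸ 2) ⊓ length (l P) + 2            ≤⟨ +-monoˡ-≤ 2 (m⊓n≤m (2 * k ∸ 2) _) ⟩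
          2 * k ∸ 2 + 2                             ≡⟨ m∸n+n≡m (≤-trans (≤-trans (s≤s (s≤s z≤n)) 4≤k) (m≤n*m k 2)) ⟩
          2 * k                                     ∎
          where
          ≤1 : degC s ≤ 1
          ≤1 with few-attachments s∈
          ... | inj₁ ≤1 = ≤1
          ... | inj₂ (_ , short) = ⊥-elim (long-path short)

    removable : (∀ {v} → H v ≡ true → degC v ≤ k) → ∀ {v} → H v ≡ true → ∃ Removable
    removable degC≤k {v} h with Fin.any? (λ u → (H u Bool.≟ true) ×-dec (deg H u + degC u ≤? k))
    ... | yes (u , hu , low) = _ , low-degree-removable hu low
    ... | no none with good-path (path stop ([] ∷ []) (h ∷ []))
    ... | P , good = _ , rotation-removable degC≤k (λ {u} hu → ≰⇒> (λ le → none (u , hu , le))) P good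

𝟙-∧ : ∀ a b → 𝟙 (a ∧ b) ≡ 𝟙 a * 𝟙 b
𝟙-∧ true b = sym (+-identityʳ (𝟙 b))
𝟙-∧ false b = refl

-- Double counting

module DoubleCounting {n : ℕ} (G : Graph n) where

  -- Vertex sets are replaced by functions to ℕ, so that disjoint unions become pointwise sums.
  degree : (Fin n → ℕ) → Fin n → ℕ
  degree f v = sum (λ w → f w * 𝟙 (adj G v w))

  -- Each edge inside f is counted twice.
  weight : (Fin n → ℕ) → (Fin n → ℕ) → ℕ
  weight d f = sum (λ v → f v * (degree f v + d v))

  degree-+ : ∀ f g v → degree (λ w → f w + g w) v ≡ degree f v + degree g v
  degree-+ f g v = trans (sum-cong-≗ (λ w → *-distribʳ-+ (𝟙 (adj G v w)) (f w) (g w))) (∑-distrib-+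
      (λ w → f w * 𝟙 (adj G v w)) (λ w → g w * 𝟙 (adj G v w)))

  -- Both sides count the edges between `f` and `g`, from either end.
  cross-sym : ∀ f g → sum (λ v → f v * degree g v) ≡ sum (λ v → g v * degree f v)
  cross-sym f g = begin
    sum (λ v → f v * degree g v)
        ≡⟨ sum-cong-≗ (λ v → *-distribˡ-sum (f v) (λ w → g w * 𝟙 (adj G v w))) ⟩
    sum (λ v → sum (λ w → f v * (g w * 𝟙 (adj G v w))))       ≡⟨ ∑-comm (λ v w → f v * (g w * 𝟙 (adj G v w))) ⟩
    sum (λ w → sum (λ v → f v * (g w * 𝟙 (adj G v w))))
        ≡⟨ sum-cong-≗ (λ w → sum-cong-≗ (λ v → swap (f v) (g w) (adj-sym G v w))) ⟩
    sum (λ w → sum (λ v → g w * (f v * 𝟙 (adj G w v))))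
        ≡⟨ sum-cong-≗ (λ w → *-distribˡ-sum (g w) (λ v → f v * 𝟙 (adj G w v))) ⟨
    sum (λ w → g w * degree f w)                              ∎
    where
    open ≡-Reasoning
    swap : ∀ a b {p q} → p ≡ q → a * (b * 𝟙 p) ≡ b * (a * 𝟙 q)
    swap a b {p} refl = eq a b (𝟙 p)
      where
      eq : ∀ a b c → a * (b * c) ≡ b * (a * c)
      eq = solve-∀

  -- Edges between `f` and `g` are counted at both ends; `cross-sym` moves the count at the end in
  -- `f` to the end in `g`, which explains the extra `degree f v`.
  weight-+ : ∀ d f g → weight d (λ v → f v + g v) ≡
    weight d f + sum (λ v → g v * (degree (λ w → f w + g w) v + degree f v + d v))
  weight-+ d f g = begin
    sum (λ v → (f v + g v) * (degree h v + d v))                    ≡⟨ sum-cong-≗ expand ⟩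
    sum (λ v → f v * (degree f v + d v) + f v * degree g v + g v * (degree h v + d v))
      ≡⟨ trans (∑-distrib-+ (λ v → A v + B v) D) (cong (_+ sum D) (∑-distrib-+ A B)) ⟩
    weight d f + sum (λ v → f v * degree g v) + sum (λ v → g v * (degree h v + d v))
      ≡⟨ cong (λ z → weight d f + z + sum (λ v → g v * (degree h v + d v))) (cross-sym f g) ⟩
    weight d f + sum (λ v → g v * degree f v) + sum (λ v → g v * (degree h v + d v))
      ≡⟨ +-assoc (weight d f) _ _ ⟩
    weight d f + (sum (λ v → g v * degree f v) + sum (λ v → g v * (degree h v + d v)))
      ≡⟨ cong (weight d f +_) (trans (sym (∑-distrib-+ (λ v → g v * degree f v) D)) (sum-cong-≗
          (λ v → collect (g v) (degree f v) (degree h v) (d v)))) ⟩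
    weight d f + sum (λ v → g v * (degree h v + degree f v + d v))  ∎
    where
    open ≡-Reasoning
    h : Fin n → ℕ
    h v = f v + g v
    A B D : Fin n → ℕ
    A v = f v * (degree f v + d v)
    B v = f v * degree g v
    D v = g v * (degree h v + d v)
    collect : ∀ g a b d → g * a + g * (b + d) ≡ g * (b + a + d)
    collect = solve-∀
    expand : ∀ v → (f v + g v) * (degree h v + d v) ≡
      f v * (degree f v + d v) + f v * degree g v + g v * (degree h v + d v)
    expand v rewrite degree-+ f g v = eq (f v) (g v) (degree f v) (degree g v) (d v)
      where
      eq : ∀ f g a b d → (f + g) * (a + b + d) ≡ f * (a + d) + f * b + g * (a + b + d)
      eq = solve-∀

  weight-cong : ∀ d {f g} → (∀ v → f v ≡ g v) → weight d f ≡ weight d g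
  weight-cong d h = sum-cong-≗ (λ v → cong₂ _*_ (h v) (cong (_+ d v) (sum-cong-≗ (λ w → cong (_* 𝟙
      (adj G v w)) (h w)))))

  degree-# : ∀ (P : Fin n → Bool) v → degree (λ w → 𝟙 (P w)) v ≡ # (λ w → P w ∧ adj G v w)
  degree-# P v = sym (trans (#-sum (λ w → P w ∧ adj G v w)) (sum-cong-≗ (λ w → 𝟙-∧ (P w) (adj G v w))))

  -- Every edge is counted once from its smaller and once from its larger end.
  edges-inside : ∀ (P : Fin n → Bool) → let Edge = λ x y → P x ∧ P y ∧ adj G x y ∧ does (suc (toℕ x) ≤? toℕ y) in
    2 * sum (λ x → # (Edge x)) ≡ sum (λ x → 𝟙 (P x) * degree (λ w → 𝟙 (P w)) x)
  edges-inside P = begin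
    2 * sum (λ x → # (Edge x))                                ≡⟨ cong (2 *_) (sum-cong-≗ (λ x → #-sum (Edge x))) ⟩
    2 * sum (λ x → sum (λ y → 𝟙 (Edge x y)))                  ≡⟨ cong (total +_) (+-identityʳ total) ⟩
    total + total                                             ≡⟨ cong (total +_) (∑-comm (λ x y → 𝟙 (Edge x y))) ⟩
    total + sum (λ y → sum (λ x → 𝟙 (Edge x y)))              ≡⟨ trans (sum-cong-≗ (λ x → ∑-distrib-+
        (λ y → 𝟙 (Edge x y)) (λ y → 𝟙 (Edge y x)))) (∑-distrib-+ (λ x → sum (λ y → 𝟙 (Edge x y))) (λ x → sum
            (λ y → 𝟙 (Edge y x)))) ⟨
    sum (λ x → sum (λ y → 𝟙 (Edge x y) + 𝟙 (Edge y x)))       ≡⟨ sum-cong-≗ (λ x → sum-cong-≗ (λ y → once x y)) ⟩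
    sum (λ x → sum (λ y → 𝟙 (P x) * (𝟙 (P y) * 𝟙 (adj G x y))))
        ≡⟨ sum-cong-≗ (λ x → *-distribˡ-sum (𝟙 (P x)) (λ y → 𝟙 (P y) * 𝟙 (adj G x y))) ⟨
    sum (λ x → 𝟙 (P x) * degree (λ w → 𝟙 (P w)) x)            ∎
    where
    open ≡-Reasoning
    Edge : Fin n → Fin n → Bool
    Edge x y = P x ∧ P y ∧ adj G x y ∧ does (suc (toℕ x) ≤? toℕ y)
    total : ℕ
    total = sum (λ x → sum (λ y → 𝟙 (Edge x y)))
    once : ∀ x y → 𝟙 (Edge x y) + 𝟙 (Edge y x) ≡ 𝟙 (P x) * (𝟙 (P y) * 𝟙 (adj G x y))
    once x y rewrite adj-sym G y x = cases (P x) (P y) (adj G x y) _ _ (order x y)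
      where
      cases : ∀ p q a l m → (a ≡ true → 𝟙 l + 𝟙 m ≡ 1) → 𝟙 (p ∧ q ∧ a ∧ l) + 𝟙 (q ∧ p ∧ a ∧ m) ≡ 𝟙 p * (𝟙 q * 𝟙 a)
      cases false false _ _ _ _ = refl
      cases false true _ _ _ _ = refl
      cases true false _ _ _ _ = refl
      cases true true false _ _ _ = refl
      cases true true true _ _ h = h refl
      order : ∀ x y → adj G x y ≡ true → 𝟙 (does (suc (toℕ x) ≤? toℕ y)) + 𝟙 (does (suc (toℕ y) ≤? toℕ x)) ≡ 1
      order x y e with <-cmp (toℕ x) (toℕ y)
      ... | tri< x<y _ y≮x = cong₂ (λ a b → 𝟙 a + 𝟙 b) (dec-true (_ ≤? _) x<y) (dec-false (_ ≤? _) y≮x)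
      ... | tri≈ _ x≡y _ = ⊥-elim (adj-≢ G e (Fin.toℕ-injective x≡y))
      ... | tri> x≮y _ y<x = cong₂ (λ a b → 𝟙 a + 𝟙 b) (dec-false (_ ≤? _) x≮y) (dec-true (_ ≤? _) y<x)

-- The edge bound and the conclusion

module _ {n : ℕ} (G : Graph n) {c : ℕ} (C : Fin c → Fin n) (long : IsLongestCycle G c C)
  (connected : Connected G) (connectedMinus : ∀ v → ConnectedMinus G v) {k : ℕ}
  (4≤k : 4 ≤ k) (c≤ : c ≤ 2 * k + 3) where

  open LongestCycle G C long
  open Attachments G C long connected connectedMinus 4≤k c≤
  open Removal G C long connected connectedMinus 4≤k c≤
  open DoubleCounting G

  Weight : (Fin n → Bool) → ℕ
  Weight H = weight (λ v → 2 * degC v) (λ v → 𝟙 (H v))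

  -- Induction on the size of `H`: a removable set takes away at most 2k for each of its vertices.
  weight-bound : ∀ H → (∀ {v} → H v ≡ true → Outside v) → (∀ {v} → H v ≡ true → degC v ≤ k) →
    Acc _<_ (# H) → Weight H ≤ 2 * k * # H
  weight-bound H out low (acc rec) with Fin.any? (λ v → H v Bool.≟ true)
  ... | no none = ≤-trans (≤-reflexive empty) z≤n
    where
    empty : Weight H ≡ 0
    empty = trans (sum-cong-≗ (λ v → cong (λ b → 𝟙 b * (degree (λ w → 𝟙 (H w)) v + 2 * degC v)) (Bool.¬-not
        (λ e → none (v , e)))))
      (n≤0⇒n≡0 (zeros n))
      where
      zeros : ∀ m → sum {m} (λ _ → 0) ≤ 0
      zeros zero = z≤n
      zeros (suc m) = zeros m
  ... | yes (v , h) with removable H out low h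
  ... | S , uniq , (s , s∈) , S⊆H , bound = begin
      Weight H                                        ≡⟨ weight-cong d split ⟩
      weight d (λ v → 𝟙 (H′ v) + 𝟙 (inS v))           ≡⟨ weight-+ d (λ v → 𝟙 (H′ v)) (λ v → 𝟙 (inS v)) ⟩
      Weight H′ + sum (λ v → 𝟙 (inS v) * (degree (λ w → 𝟙 (H′ w) + 𝟙 (inS w)) v + degree (λ w → 𝟙 (H′ w)) v + d v))
                                                      ≤⟨ +-mono-≤ (weight-bound H′ (out ∘ ∖-⊆ H S)
                                                          (low ∘ ∖-⊆ H S) (rec smaller)) (sum-mono removed) ⟩
      2 * k * # H′ + sum (λ v → 2 * k * 𝟙 (inS v))
          ≡⟨ cong (2 * k * # H′ +_) (trans (cong (2 * k *_) (#-sum inS)) (*-distribˡ-sum (2 * k) (λ v → 𝟙 (inS v)))) ⟨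
      2 * k * # H′ + 2 * k * # inS                    ≡⟨ *-distribˡ-+ (2 * k) (# H′) (# inS) ⟨
      2 * k * (# H′ + # inS)                          ≡⟨ cong (2 * k *_) size ⟨
      2 * k * # H                                     ∎
    where
    open ≤-Reasoning
    d : Fin n → ℕ
    d v = 2 * degC v
    inS H′ : Fin n → Bool
    inS v = does (v ∈? S)
    H′ = H ∖ S
    split : ∀ v → 𝟙 (H v) ≡ 𝟙 (H′ v) + 𝟙 (inS v)
    split v with v ∈? S
    ... | yes v∈ rewrite S⊆H v∈ = refl
    ... | no v∉ = trans (cong 𝟙 (sym (Bool.∧-identityʳ (H v)))) (sym (+-identityʳ _))
    size : # H ≡ # H′ + # inS
    size = trans (#-sum H) (trans (sum-cong-≗ split) (trans (∑-distrib-+ (λ v → 𝟙 (H′ v)) (λ v → 𝟙 (inS v)))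
        (sym (cong₂ _+_ (#-sum H′) (#-sum inS)))))
    smaller : # H′ < # H
    smaller = subst (# H′ <_) (sym size) (m<m+n (# H′) (length≤# {p = inS} {l = [ s ]} ([] ∷ []) λ {
        (here refl) → dec-true (s ∈? S) s∈ }))
    removed : ∀ v → 𝟙 (inS v) * (degree (λ w → 𝟙 (H′ w) + 𝟙 (inS w)) v + degree (λ w → 𝟙
        (H′ w)) v + d v) ≤ 2 * k * 𝟙 (inS v)
    removed v with v ∈? S
    ... | no _ = z≤n
    ... | yes v∈ = begin
      1 * (degree (λ w → 𝟙 (H′ w) + 𝟙 (inS w)) v + degree (λ w → 𝟙 (H′ w)) v + d v)   ≡⟨ *-identityˡ _ ⟩
      degree (λ w → 𝟙 (H′ w) + 𝟙 (inS w)) v + degree (λ w → 𝟙 (H′ w)) v + d v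
        ≡⟨ cong₂ (λ a b → a + b + d v) (trans (sum-cong-≗ (λ w → cong (_* 𝟙 (adj G v w)) (sym (split w))))
            (degree-# H v)) (degree-# H′ v) ⟩
      deg H v + deg H′ v + 2 * degC v   ≤⟨ bound v∈ ⟩
      2 * k                             ≡⟨ *-identityʳ (2 * k) ⟨
      2 * k * 1                         ∎

  out : Fin n → Bool
  out v = not (onCycle C v)

  -- Edges outside the cycle are counted from both ends; edges to the cycle are seen from one end
  -- only and get their factor 2 from the vertex weight.
  Weight-edges : 2 * (eOutside G C + eBetween G C) ≡ Weight out
  Weight-edges = begin
    2 * (eOutside G C + eBetween G C)
        ≡⟨ cong (2 *_) (cong₂ _+_ (countPairs-sum Edge) (countPairs-sum Cross)) ⟩
    2 * (sum (λ x → # (Edge x)) + sum (λ x → # (Cross x)))  ≡⟨ *-distribˡ-+ 2 (sum (λ x → # (Edge x))) _ ⟩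
    2 * sum (λ x → # (Edge x)) + 2 * sum (λ x → # (Cross x)) ≡⟨ cong₂ _+_ (edges-inside out) cross ⟩
    sum (λ x → 𝟙 (out x) * degree (λ w → 𝟙 (out w)) x) + sum (λ x → 𝟙 (out x) * (2 * degC x))
        ≡⟨ ∑-distrib-+ (λ x → 𝟙 (out x) * degree (λ w → 𝟙 (out w)) x) (λ x → 𝟙 (out x) * (2 * degC x)) ⟨
    sum (λ x → 𝟙 (out x) * degree (λ w → 𝟙 (out w)) x + 𝟙 (out x) * (2 * degC x))
        ≡⟨ sum-cong-≗ (λ x → *-distribˡ-+ (𝟙 (out x)) (degree (λ w → 𝟙 (out w)) x) (2 * degC x)) ⟨
    Weight out                                            ∎
    where
    open ≡-Reasoning
    Edge Cross : Fin n → Fin n → Bool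
    Edge x y = out x ∧ out y ∧ adj G x y ∧ does (suc (toℕ x) ≤? toℕ y)
    Cross x y = out x ∧ onCycle C y ∧ adj G x y
    guard : ∀ b (q : Fin n → Bool) → 2 * # (λ y → b ∧ q y) ≡ 𝟙 b * (2 * # q)
    guard true q = sym (*-identityˡ _)
    guard false q = cong (2 *_) (none (allFin n))
      where
      none : ∀ l → count {Fin n} (λ _ → false) l ≡ 0
      none [] = refl
      none (_ ∷ l) = none l
    cross : 2 * sum (λ x → # (Cross x)) ≡ sum (λ x → 𝟙 (out x) * (2 * degC x))
    cross = trans (*-distribˡ-sum 2 (λ x → # (Cross x))) (sum-cong-≗ (λ x → guard (out x)
        (λ y → onCycle C y ∧ adj G x y)))

  out-Outside : ∀ {v} → out v ≡ true → Outside v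
  out-Outside {v} e with onCycle C v
  ... | false = refl

  #-out : # out ≡ n ∸ c
  #-out = sym (trans (cong (_∸ c) (sym total)) (trans (cong (_∸ c) (+-comm c (# out))) (m+n∸n≡m (# out) c)))
    where
    on-cycle : # (onCycle C) ≡ c
    on-cycle = trans (count-cong (λ v → sym (Bool.∧-identityʳ (onCycle C v))) (allFin n))
      (trans (#-onCycle C C-injective (λ _ → true)) (trans (all (allFin c)) (length-tabulate (λ i → i))))
      where
      all : ∀ l → count {Fin c} (λ _ → true) l ≡ length l
      all [] = refl
      all (_ ∷ l) = cong suc (all l)
    total : c + # out ≡ n
    total = trans (cong (_+ # out) (sym on-cycle)) (trans (count-not (onCycle C) (allFin n))
        (length-tabulate (λ i → i)))

  edge-bound : (∀ {v} → Outside v → degC v ≤ k) → eOutside G C + eBetween G C ≤ k * (n ∸ c)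
  edge-bound low = *-cancelˡ-≤ 2 (begin
    2 * (eOutside G C + eBetween G C)   ≡⟨ Weight-edges ⟩
    Weight out                          ≤⟨ weight-bound out out-Outside (low ∘ out-Outside) (<-wellFounded _) ⟩
    2 * k * # out                       ≡⟨ cong (2 * k *_) #-out ⟩
    2 * k * (n ∸ c)                     ≡⟨ *-assoc 2 k (n ∸ c) ⟩
    2 * (k * (n ∸ c))                   ∎)
    where open ≤-Reasoning

  -- A vertex with k + 1 neighbours on the cycle is isolated by `non-isolated-degC`; without such a
  -- vertex `edge-bound` contradicts the hypothesis.
  exists-full-isolated : k * (n ∸ c) < eOutside G C + eBetween G C →
    ∃ λ u → IsolatedOutside G C u × degOnCycle G C u ≡ suc k
  exists-full-isolated many
    with Fin.any? (λ u → (onCycle C u Bool.≟ false) ×-dec (degC u ≟ suc k))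
  ... | yes (u , off , full) = u , (off , isolated) , full
    where
    isolated : ∀ w → onCycle C w ≡ false → adj G u w ≡ false
    isolated w off-w = Bool.¬-not (λ e → 1+n≰n (subst (_≤ k) full (non-isolated-degC off off-w e)))
  ... | no none = ⊥-elim (<⇒≱ many (edge-bound (λ {v} off →
          s≤s⁻¹ (≤∧≢⇒< (degC≤suc-k off) (λ e → none (v , off , e))))))

theorem3p1 : (n : ℕ) (G : Graph n) → TwoConnected G →
    (c : ℕ) (C : Fin c → Fin n) → IsLongestCycle G c C →
    10 ≤ c → c ≤ n ∸ 1 →
    (⌊ c /2⌋ ∸ 1) * (n ∸ c) < eOutside G C + eBetween G C →
    ∃ λ (u : Fin n) → IsolatedOutside G C u × degOnCycle G C u ≡ ⌊ c /2⌋
theorem3p1 n G (_ , connected , connectedMinus) c C long 10≤c _ many =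
  -- Here k is ⌊c/2⌋ - 1, so 10 ≤ c gives 4 ≤ k, and `suc k` is ⌊c/2⌋ again because the truncated
  -- subtraction is exact.
  subst (λ h → ∃ λ u → IsolatedOutside G C u × degOnCycle G C u ≡ h) (m+[n∸m]≡n (≤-trans (s≤s z≤n) 5≤h))
    (exists-full-isolated G C long connected connectedMinus (∸-monoˡ-≤ 1 5≤h) c≤ many)
  where
  5≤h : 5 ≤ ⌊ c /2⌋
  5≤h = ⌊n/2⌋-mono 10≤c
  half : ∀ c → c ≤ 2 * ⌊ c /2⌋ + 1
  half 0 = z≤n
  half 1 = s≤s z≤n
  half (suc (suc c)) = ≤-trans (s≤s (s≤s (half c))) (≤-reflexive (eq ⌊ c /2⌋))
    where
    eq : ∀ h → suc (suc (2 * h + 1)) ≡ 2 * suc h + 1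
    eq = solve-∀
  c≤ : c ≤ 2 * (⌊ c /2⌋ ∸ 1) + 3
  c≤ = ≤-trans (half c) (≤-reflexive (trans (cong (λ h → 2 * h + 1) (sym (m+[n∸m]≡n (≤-trans
      (s≤s z≤n) 5≤h)))) (eq (⌊ c /2⌋ ∸ 1))))
    where
    eq : ∀ k → 2 * suc k + 1 ≡ 2 * k + 3
    eq = solve-∀
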